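{- Let $D$ be a division ring, and let $A$ be a finite non-empty subset of $D$ such that $|A+A| \leq K|A|$ and $|A \cdot A| \leq K|A|$ for some $K \geq 1$. Then there exists a finite subring $S$ of $D$ of cardinality $|S| \ll K^{O(1)} |A|$ and an invertible element $a \in A$ such that $a \cdot S = S \cdot a$ and $A \subset a \cdot S + \mathbf{O}( K^{O(1)} )$.
   Context: A division ring is a ring with identity, not necessarily commutative, in which every non-zero element is invertible. Rings are not required to be commutative or to contain a multiplicative identity; accordingly a subring is an additive subgroup closed under multiplication (it is not required to contain the identity). For subsets $A,B$ of a ring: $A+B := \{a+b : a\in A, b\in B\}$, $A\cdot B := \{ab : a\in A, b\in B\}$; $r\cdot A := \{ra : a\in A\}$ and $A\cdot r := \{ar : a \in A\}$ for a ring element $r$. $|A|$ denotes the cardinality of a finite set $A$. $X \ll Y$ means $X \leq CY$ for some absolute constant $C$; $O(1)$ denotes a quantity bounded by an absolute constant. $\mathbf{O}(N)$ denotes an unspecified finite non-empty subset of the ring of cardinality $O(N)$; thus $A \subset a\cdot S + \mathbf{O}(K^{O(1)})$ means that there is a finite non-empty set $X$ in the ring with $|X| = O(K^{O(1)})$ such that $A \subset a\cdot S + X$. All implied constants are absolute (independent of $D$, $A$, $K$).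
   Formalization: The case A = {0} is excluded, since then A contains no invertible element and the claim fails; K is taken rational, which is equivalent as the least admissible K is rational; equality in D is assumed decidable, which holds classically. -}

module Defs where

open import Algebra.Bundles using (Ring)
import Algebra.Definitions
import Algebra.Definitions.RawSemiring
open import Data.Integer.Base using (+_)
open import Data.List.Base
  using (List; []; length; map; deduplicate; cartesianProductWith)
import Data.List.Membership.Setoid
import Data.List.Relation.Binary.Subset.Setoid
open import Data.Nat.Base using (ℕ)
open import Data.Product.Base using (_×_)
open import Data.Rational.Base using (ℚ; _/_; +-*-rawSemiring)
open import Level using (_⊔_)
open import Relation.Binary.Definitions using (Decidable)
open import Relation.Binary.PropositionalEquality.Core using (_≢_)
open import Relation.Nullary.Negation.Core using (¬_)

fromℕ : ℕ → ℚ
fromℕ n = + n / 1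

open Algebra.Definitions.RawSemiring +-*-rawSemiring public using (_^_)

module _ {c ℓ} (R : Ring c ℓ) where
  open Ring R

  IsInvertible : Carrier → Set (c ⊔ ℓ)
  IsInvertible = Algebra.Definitions.Invertible _≈_ 1# _*_

  IsDivisionRing : Set (c ⊔ ℓ)
  IsDivisionRing = ∀ x → ¬ (x ≈ 0#) → IsInvertible x

-- A finite subset of R is presented by a list enumerating its elements, in any
-- order and possibly with repetitions.  Membership, inclusion and equality
-- below are those of the enumerated sets, up to the equality _≈_ of R.
module FiniteSubsets {c ℓ} (R : Ring c ℓ) (_≟_ : Decidable (Ring._≈_ R)) where
  open Ring R
  open Data.List.Membership.Setoid setoid public using (_∈_)
  open Data.List.Relation.Binary.Subset.Setoid setoid public using (_⊆_)

  infix  4 _≐_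
  infixl 6 _⊕_
  infixl 7 _⊗_ _·ˡ_ _·ʳ_

  FinSubset : Set c
  FinSubset = List Carrier

  -- Repetitions are removed before counting, so this is the cardinality of the
  -- enumerated set; it is the only use of decidability of _≈_.
  ∣_∣ : FinSubset → ℕ
  ∣ A ∣ = length (deduplicate _≟_ A)

  NonEmpty : FinSubset → Set c
  NonEmpty A = A ≢ []

  _≐_ : FinSubset → FinSubset → Set (c ⊔ ℓ)
  A ≐ B = (A ⊆ B) × (B ⊆ A)

  _⊕_ : FinSubset → FinSubset → FinSubset
  _⊕_ = cartesianProductWith _+_

  _⊗_ : FinSubset → FinSubset → FinSubset
  _⊗_ = cartesianProductWith _*_

  _·ˡ_ : Carrier → FinSubset → FinSubset
  r ·ˡ A = map (r *_) A

  _·ʳ_ : FinSubset → Carrier → FinSubset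
  A ·ʳ r = map (_* r) A

  -- A subring need not contain 1#.
  record IsSubring (S : FinSubset) : Set (c ⊔ ℓ) where
    field
      0#-mem   : 0# ∈ S
      +-closed : ∀ {x y} → x ∈ S → y ∈ S → (x + y) ∈ S
      -‿closed : ∀ {x} → x ∈ S → (- x) ∈ S
      *-closed : ∀ {x y} → x ∈ S → y ∈ S → (x * y) ∈ S

-- Call x good if x A is covered by boundedly many translates of H = A - A, all
-- bounds being powers of k ≈ 4 K.  By Plünnecke's inequality and Ruzsa covering
-- the good elements are closed, with a polynomial loss, under sums, products
-- and inverses.  Multiplicative energy gives b ∈ A and a large A′ ⊆ A all of
-- whose a A meet b A substantially, so the elements of B = b⁻¹ A′ are good, and
-- with them the quotients (u - u′)(v - v′)⁻¹ of differences of B.  Conversely,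
-- if x is not such a quotient for A′, then (u , v) ↦ u + x v is injective on
-- A′ × A′, which is impossible for good x once A is large.  Hence
--   Quotient B ⊆ {good elements} ⊆ Quotient A′ = b (Quotient B) b⁻¹,
-- and comparing cardinalities makes these equal: S = Quotient B is a subring
-- normalised by b, with A′ ⊆ b S, and A is covered by translates of A′ - A′.
-- If A is small, S = {0} will do.

module Submission where

open import Defs
open import Algebra.Bundles using (CommutativeMonoid; Ring)
import Algebra.Properties.AbelianGroup
import Algebra.Properties.CommutativeSemigroup
import Algebra.Properties.Ring
open import Data.Empty using (⊥; ⊥-elim)
import Data.Integer.Base as ℤ
import Data.Integer.Properties as ℤ
open import Data.List.Base
  using (List; []; _∷_; [_]; _++_; length; map; filter; deduplicate; cartesianProduct; cartesianProductWith; take)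
import Data.List.Membership.Propositional as Propositional
import Data.List.Membership.Propositional.Properties as Propositional
import Data.List.Membership.Setoid
import Data.List.Membership.Setoid.Properties as Membership
open import Data.List.Properties using (length-map; length-++; length-removeAt′; length-take)
open import Data.List.Relation.Binary.Sublist.Propositional as Sublist using ([]; _∷_; _∷ʳ_)
open import Data.List.Relation.Binary.Sublist.Propositional.Properties using (filter-⊆)
open import Data.List.Relation.Unary.All as All using (All; []; _∷_)
open import Data.List.Relation.Unary.All.Properties using (¬Any⇒All¬)
open import Data.List.Relation.Unary.AllPairs using (AllPairs; []; _∷_)
open import Data.List.Relation.Unary.Any as Any using (Any; here; there)
open import Data.List.Relation.Unary.Unique.DecSetoid.Properties using (deduplicate-!)
open import Data.List.Relation.Unary.Unique.Setoid using (Unique)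
import Data.List.Relation.Unary.Unique.Setoid.Properties as Unique
open import Data.Nat.Base as ℕ using (ℕ; zero; suc)
import Data.Nat.Properties as ℕ
open import Data.Nat.Tactic.RingSolver using (solve-∀)
open import Data.Product.Base using (∃-syntax; _×_; _,_; proj₁; proj₂)
open import Data.Product.Relation.Binary.Pointwise.NonDependent using (_×ₛ_)
import Data.Rational.Base as ℚ
import Data.Rational.Properties as ℚ
import Data.Rational.Unnormalised.Base as ℚᵘ
import Data.Rational.Unnormalised.Properties as ℚᵘ
open import Data.Sum.Base using (_⊎_; inj₁; inj₂; [_,_]′)
open import Function.Base using (_∘_; id)
open import Level using (Level; _⊔_)
open import Relation.Binary.Bundles using (Setoid; DecSetoid)
import Relation.Binary.Construct.On as On
open import Relation.Binary.Core using (REL; Rel; _Preserves_⟶_; _Preserves₂_⟶_⟶_)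
open import Relation.Binary.Definitions using (Decidable; _Respects_)
open import Relation.Binary.PropositionalEquality as ≡ using (_≡_)
import Relation.Binary.Reasoning.Setoid
open import Relation.Nullary.Decidable using (Dec; yes; no; ¬?; _×-dec_; decidable-stable)
open import Relation.Nullary.Negation.Core using (¬_)
open import Relation.Unary using (Pred)
import Relation.Unary as Unary

open Algebra.Properties.CommutativeSemigroup ℕ.+-commutativeSemigroup using ()
  renaming (interchange to ℕ-+-interchange)
open Algebra.Properties.CommutativeSemigroup ℕ.*-commutativeSemigroup using ()
  renaming (interchange to ℕ-*-interchange; xy∙z≈xz∙y to ℕ-*-swapʳ)

-- Each closure property of good elements loses a polynomial factor, so the elements good for one
-- fixed bound need not form a ring. The loss is stopped by a gap: once `A` is large, every element
-- good with the generous bound `ε₃ k` is a quotient, and every quotient of `B` is good with the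
-- smaller bound `ε₂ k`. Sums and products of elements of `S` thus always start from `ε₂ k`, and a
-- single round of operations has to be paid for.
--
-- Goodness concerns the left dilates `x A` only. Without commutativity, multiplying a set by `g` on
-- the left conjugates its quotients by `g`: this is why `Quotient A′` and `Quotient B` are a priori
-- different, why they nevertheless have the same size, and where `b S = S b` comes from.
--
-- Zero is discarded first, because products must be cancellable; that may halve the set, and
-- rounding `K` up to an integer may double it, whence `k ≈ 4 K`. The set `{0}` contains no
-- invertible element and has to be excluded.

private
  variable
    a a′ p q r ℓ₁ ℓ₂ : Level
    A₁ : Set a
    A₂ : Set a′

-- Counting by injections

Any-─⁺ : {P : Pred A₁ p} {Q : Pred A₁ q} → (∀ {x} → P x → Q x → ⊥) →
         ∀ {xs} (i : Any P xs) → Any Q xs → Any Q (xs Any.─ i)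
Any-─⁺ P#Q (here px) (here qx) = ⊥-elim (P#Q px qx)
Any-─⁺ P#Q (here px) (there j) = j
Any-─⁺ P#Q (there i) (here qx) = here qx
Any-─⁺ P#Q (there i) (there j) = there (Any-─⁺ P#Q i j)

module _ (R : REL A₁ A₂ r) where

  NoCommonImage : Rel A₁ _
  NoCommonImage x x′ = ∀ {y} → R x y → R x′ y → ⊥

  -- Induction on `xs`: an image of the head is deleted from `ys`, and since no image is shared, the
  -- images of the other entries survive the deletion. Working with a relation avoids choosing
  -- images.
  length-mono-injective : ∀ {xs ys} → AllPairs NoCommonImage xs →
                          All (λ x → Any (R x) ys) xs → length xs ℕ.≤ length ys
  length-mono-injective []         []          = ℕ.z≤n
  length-mono-injective {x ∷ xs} {ys} (x# ∷ xs#) (i ∷ is) = ℕ.≤-trans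
    (ℕ.s≤s (length-mono-injective xs#
      (All.zipWith {P = NoCommonImage x} (λ {x′} (x#x′ , j) → Any-─⁺ {P = R x} {Q = R x′} x#x′ i j) (x# , is))))
    (ℕ.≤-reflexive (≡.sym (length-removeAt′ ys (Any.index i))))

AllPairs-map∈ : {P : Rel A₁ p} {Q : Rel A₁ q} {xs : List A₁} →
                (∀ {x y} → x Propositional.∈ xs → y Propositional.∈ xs → P x y → Q x y) →
                AllPairs P xs → AllPairs Q xs
AllPairs-map∈ f []          = []
AllPairs-map∈ f (px ∷ pxs) =
  All.tabulate (λ y∈ → f (here ≡.refl) (there y∈) (All.lookup px y∈)) ∷
  AllPairs-map∈ (λ x∈ y∈ → f (there x∈) (there y∈)) pxs

module _ (S : Setoid a ℓ₁) (T : Setoid a′ ℓ₂) where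
  private
    module S = Setoid S
    module T = Setoid T
  open Data.List.Membership.Setoid S using () renaming (_∈_ to _∈₁_)
  open Data.List.Membership.Setoid T using () renaming (_∈_ to _∈₂_)

  length-mono-map : (f : S.Carrier → T.Carrier) → ∀ {xs ys} → Unique S xs →
                    (∀ {x} → x ∈₁ xs → f x ∈₂ ys) →
                    (∀ {x y} → x ∈₁ xs → y ∈₁ xs → f x T.≈ f y → x S.≈ y) →
                    length xs ℕ.≤ length ys
  length-mono-map f {xs} {ys} xs! f∈ inj =
    length-mono-injective (λ x y → f x T.≈ y)
      (AllPairs-map∈ (λ x∈ y∈ x≉y fx fy → x≉y (inj (∈ₚ⇒∈ x∈) (∈ₚ⇒∈ y∈) (T.trans fx (T.sym fy)))) xs!)
      (All.tabulate (λ x∈ → f∈ (∈ₚ⇒∈ x∈)))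
    where
    ∈ₚ⇒∈ : ∀ {x} → x Propositional.∈ xs → x ∈₁ xs
    ∈ₚ⇒∈ = Any.map S.reflexive

-- Upgrades equivalence to identity, as a list without repetitions holds one entry per class.
-- Ruzsa's triangle inequality needs this to recover the chosen pair from its difference.
∈-Unique⇒≡ : (S : Setoid a ℓ₁) → ∀ {xs x y} → Unique S xs → x Propositional.∈ xs →
             y Propositional.∈ xs → Setoid._≈_ S x y → x ≡ y
∈-Unique⇒≡ S (_ ∷ _)   (here ≡.refl) (here ≡.refl) _   = ≡.refl
∈-Unique⇒≡ S (x≉ ∷ _)  (here ≡.refl) (there y∈)    x≈y = ⊥-elim (All.lookup x≉ y∈ x≈y)
∈-Unique⇒≡ S (y≉ ∷ _)  (there x∈)    (here ≡.refl) x≈y = ⊥-elim (All.lookup y≉ x∈ (Setoid.sym S x≈y))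
∈-Unique⇒≡ S (_ ∷ xs!) (there x∈)    (there y∈)    x≈y = ∈-Unique⇒≡ S xs! x∈ y∈ x≈y

length-cartesianProduct : (xs : List A₁) (ys : List A₂) →
                          length (cartesianProduct xs ys) ≡ length xs ℕ.* length ys
length-cartesianProduct []       ys = ≡.refl
length-cartesianProduct (x ∷ xs) ys = ≡.trans (length-++ (map (x ,_) ys))
  (≡.cong₂ ℕ._+_ (length-map (x ,_) ys) (length-cartesianProduct xs ys))

length-cartesianProductWith : ∀ {c} {C : Set c} (f : A₁ → A₂ → C) (xs : List A₁) (ys : List A₂) →
                              length (cartesianProductWith f xs ys) ≡ length xs ℕ.* length ys
length-cartesianProductWith f []       ys = ≡.refl
length-cartesianProductWith f (x ∷ xs) ys = ≡.trans (length-++ (map (f x) ys))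
  (≡.cong₂ ℕ._+_ (length-map (f x) ys) (length-cartesianProductWith f xs ys))

-- Sums over lists

∑ : List A₁ → (A₁ → ℕ) → ℕ
∑ []       f = 0
∑ (x ∷ xs) f = f x ℕ.+ ∑ xs f

syntax ∑ xs (λ x → e) = ∑[ x ∈ xs ] e

∑-mono : ∀ xs {f g : A₁ → ℕ} → (∀ {x} → x Propositional.∈ xs → f x ℕ.≤ g x) → ∑ xs f ℕ.≤ ∑ xs g
∑-mono []       f≤g = ℕ.z≤n
∑-mono (x ∷ xs) f≤g = ℕ.+-mono-≤ (f≤g (here ≡.refl)) (∑-mono xs (f≤g ∘ there))

∑-cong : ∀ xs {f g : A₁ → ℕ} → (∀ x → f x ≡ g x) → ∑ xs f ≡ ∑ xs g
∑-cong []       f≡g = ≡.refl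
∑-cong (x ∷ xs) f≡g = ≡.cong₂ ℕ._+_ (f≡g x) (∑-cong xs f≡g)

∑-const : ∀ (xs : List A₁) n → ∑[ _ ∈ xs ] n ≡ length xs ℕ.* n
∑-const []       n = ≡.refl
∑-const (x ∷ xs) n = ≡.cong (n ℕ.+_) (∑-const xs n)

∑-+ : ∀ (xs : List A₁) f g → ∑[ x ∈ xs ] (f x ℕ.+ g x) ≡ ∑ xs f ℕ.+ ∑ xs g
∑-+ []       f g = ≡.refl
∑-+ (x ∷ xs) f g = ≡.trans (≡.cong (f x ℕ.+ g x ℕ.+_) (∑-+ xs f g)) (ℕ-+-interchange (f x) (g x) _ _)

∑-*ˡ : ∀ (xs : List A₁) n f → ∑[ x ∈ xs ] (n ℕ.* f x) ≡ n ℕ.* ∑ xs f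
∑-*ˡ []       n f = ≡.sym (ℕ.*-zeroʳ n)
∑-*ˡ (x ∷ xs) n f = ≡.trans (≡.cong (n ℕ.* f x ℕ.+_) (∑-*ˡ xs n f)) (≡.sym (ℕ.*-distribˡ-+ n (f x) _))

∑-swap : ∀ (xs : List A₁) (ys : List A₂) (f : A₁ → A₂ → ℕ) →
         ∑[ x ∈ xs ] ∑[ y ∈ ys ] f x y ≡ ∑[ y ∈ ys ] ∑[ x ∈ xs ] f x y
∑-swap []       ys f = ≡.sym (≡.trans (∑-const ys 0) (ℕ.*-zeroʳ (length ys)))
∑-swap (x ∷ xs) ys f = ≡.trans (≡.cong (∑ ys (f x) ℕ.+_) (∑-swap xs ys f))
  (≡.sym (∑-+ ys (f x) (λ y → ∑[ x ∈ xs ] f x y)))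

-- If the head falls below `n`, dropping it leaves a tail whose average is still at least `n`.
∑-pigeonhole : ∀ (x : A₁) xs f n → length (x ∷ xs) ℕ.* n ℕ.≤ ∑ (x ∷ xs) f →
               ∃[ y ] (y Propositional.∈ (x ∷ xs) × n ℕ.≤ f y)
∑-pigeonhole x []       f n le = x , here ≡.refl ,
  ≡.subst₂ ℕ._≤_ (ℕ.+-identityʳ n) (ℕ.+-identityʳ (f x)) le
∑-pigeonhole x (z ∷ zs) f n le with n ℕ.≤? f x
... | yes n≤fx = x , here ≡.refl , n≤fx
... | no  n≰fx =
  let y , y∈ , n≤fy = ∑-pigeonhole z zs f n
        (ℕ.+-cancelˡ-≤ n _ _ (ℕ.≤-trans le (ℕ.+-monoˡ-≤ _ (ℕ.<⇒≤ (ℕ.≰⇒> n≰fx)))))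
  in y , there y∈ , n≤fy

module _ {P : Pred A₁ p} (P? : Unary.Decidable P) where

  indicator : A₁ → ℕ
  indicator x with P? x
  ... | yes _ = 1
  ... | no  _ = 0

  ∑-indicator : ∀ xs → ∑ xs indicator ≡ length (filter P? xs)
  ∑-indicator []       = ≡.refl
  ∑-indicator (x ∷ xs) with P? x
  ... | yes _ = ≡.cong suc (∑-indicator xs)
  ... | no  _ = ∑-indicator xs

indicator-× : {P : Pred A₁ p} {Q : Pred A₁ q} (P? : Unary.Decidable P) (Q? : Unary.Decidable Q) → ∀ x →
              indicator P? x ℕ.* indicator Q? x ≡ indicator (λ y → P? y ×-dec Q? y) x
indicator-× P? Q? x with P? x | Q? x
... | yes _ | yes _ = ≡.refl
... | yes _ | no  _ = ≡.refl
... | no  _ | yes _ = ≡.refl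
... | no  _ | no  _ = ≡.refl

-- Sublists and minimal ratios

sublists : List A₁ → List (List A₁)
sublists []       = [] ∷ []
sublists (x ∷ xs) = map (x ∷_) (sublists xs) ++ sublists xs

∈-sublists⁺ : ∀ {xs ys : List A₁} → xs Sublist.⊆ ys → xs Propositional.∈ sublists ys
∈-sublists⁺ []                = here ≡.refl
∈-sublists⁺ {ys = y ∷ ys} (_ ∷ʳ p)     = Propositional.∈-++⁺ʳ (map (y ∷_) (sublists ys)) (∈-sublists⁺ p)
∈-sublists⁺ (≡.refl ∷ p) = Propositional.∈-++⁺ˡ (Propositional.∈-map⁺ _ (∈-sublists⁺ p))

∈-sublists⁻ : ∀ {xs} (ys : List A₁) → xs Propositional.∈ sublists ys → xs Sublist.⊆ ys
∈-sublists⁻ []       (here ≡.refl) = []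
∈-sublists⁻ (y ∷ ys) p with Propositional.∈-++⁻ (map (y ∷_) (sublists ys)) p
... | inj₂ q = y ∷ʳ ∈-sublists⁻ ys q
... | inj₁ q with Propositional.∈-map⁻ (y ∷_) q
...   | _ , s , ≡.refl = ≡.refl ∷ ∈-sublists⁻ ys s

module _ (f g : A₁ → ℕ) where

  -- The order of the ratios `f x / g x`, cross-multiplied. It holds whenever `g y` is zero, so a
  -- zero denominator acts as an infinite ratio, and transitivity needs a positive denominator in
  -- the middle.
  _≼_ : Rel A₁ _
  x ≼ y = f x ℕ.* g y ℕ.≤ f y ℕ.* g x

  ≼-trans : ∀ {x y z} → 0 ℕ.< g y → x ≼ y → y ≼ z → x ≼ z
  ≼-trans {x} {y} {z} gy>0 xy yz = ℕ.*-cancelʳ-≤ _ _ (g y) {{ℕ.>-nonZero gy>0}} (begin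
    f x ℕ.* g z ℕ.* g y ≡⟨ ℕ-*-swapʳ (f x) _ _ ⟩
    f x ℕ.* g y ℕ.* g z ≤⟨ ℕ.*-monoˡ-≤ (g z) xy ⟩
    f y ℕ.* g x ℕ.* g z ≡⟨ ℕ-*-swapʳ (f y) _ _ ⟩
    f y ℕ.* g z ℕ.* g x ≤⟨ ℕ.*-monoˡ-≤ (g x) yz ⟩
    f z ℕ.* g y ℕ.* g x ≡⟨ ℕ-*-swapʳ (f z) _ _ ⟩
    f z ℕ.* g x ℕ.* g y ∎)
    where
    open ℕ.≤-Reasoning

  minimal-ratio : ∀ x₀ → 0 ℕ.< g x₀ → ∀ xs →
                  ∃[ x ] (x Propositional.∈ (x₀ ∷ xs) × 0 ℕ.< g x × ∀ {y} → y Propositional.∈ (x₀ ∷ xs) → x ≼ y)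
  minimal-ratio x₀ pos [] = x₀ , here ≡.refl , pos , λ { (here ≡.refl) → ℕ.≤-refl }
  minimal-ratio x₀ pos (z ∷ xs) with minimal-ratio x₀ pos xs
  ... | x , x∈ , gx>0 , min with f x ℕ.* g z ℕ.≤? f z ℕ.* g x
  ...   | yes le = x , insert x∈ , gx>0 , λ where
          (here eq)          → min (here eq)
          (there (here ≡.refl)) → le
          (there (there y∈)) → min (there y∈)
    where
    insert : ∀ {y} → y Propositional.∈ (x₀ ∷ xs) → y Propositional.∈ (x₀ ∷ z ∷ xs)
    insert (here eq)  = here eq
    insert (there y∈) = there (there y∈)
  ...   | no  gt = z , there (here ≡.refl) , gz>0 , λ where
          (here eq)          → ≼-trans gx>0 z≼x (min (here eq))
          (there (here ≡.refl)) → ℕ.≤-refl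
          (there (there y∈)) → ≼-trans gx>0 z≼x (min (there y∈))
    where
    z≼x : z ≼ x
    z≼x = ℕ.<⇒≤ (ℕ.≰⇒> gt)

    -- The failed comparison makes `f x * g z` exceed `f z * g x`, which it could not if `g z` were
    -- zero.
    gz>0 : 0 ℕ.< g z
    gz>0 = ℕ.n≢0⇒n>0 λ gz≡0 → gt (≡.subst (λ n → f x ℕ.* n ℕ.≤ f z ℕ.* g x) (≡.sym gz≡0)
             (≡.subst (ℕ._≤ f z ℕ.* g x) (≡.sym (ℕ.*-zeroʳ (f x))) ℕ.z≤n))

-- 2A - 2A has at most κ k ∣A∣ elements, and ρ k translates of A - A cover it.
κ ρ : ℕ → ℕ
κ k = (k ℕ.* k) ℕ.* (k ℕ.* k)
ρ k = (k ℕ.* k ℕ.* k) ℕ.* (k ℕ.* k)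

-- The number of translates of A - A needed to cover x A, successively for x an
-- element of B, a difference, an inverse of a difference, a quotient, and a sum
-- or product of quotients; threshold is the size from which A counts as large.
ε₀ ε₁ ε₁′ ε₂ ε₃ threshold : ℕ → ℕ
ε₀ k  = 2 ℕ.* k ℕ.* (k ℕ.* k)
ε₁ k  = ρ k ℕ.* (ε₀ k ℕ.* ε₀ k)
ε₁′ k = 1 ℕ.+ κ k ℕ.* ε₁ k
ε₂ k  = ρ k ℕ.* (ε₁ k ℕ.* ε₁ k) ℕ.* ε₁′ k
ε₃ k  = (1 ℕ.+ ε₀ k) ℕ.+ (ε₂ k ℕ.+ (ρ k ℕ.* (ε₂ k ℕ.* ε₂ k) ℕ.+ ρ k ℕ.* (ε₂ k ℕ.* ε₂ k) ℕ.* ε₂ k))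
threshold k = ε₂ k ℕ.+ 2 ℕ.* k ℕ.* (2 ℕ.* k) ℕ.* (κ k ℕ.* ε₃ k)

-- The factors in the final bounds for `S` and for the number of translates. The summand `1` of `σ`
-- and the first summand of `τ` serve small sets, where `S` is `{0}` and the translates are the set
-- itself; the remaining summands serve large sets.
σ τ : ℕ → ℕ
σ k = 1 ℕ.+ κ k ℕ.* (suc (ε₂ k) ℕ.* suc (ε₂ k))
τ k = 2 ℕ.* threshold k ℕ.+ 2 ℕ.* k ℕ.* k

-- Polynomially bounded functions

PolyBounded : (ℕ → ℕ) → Set
PolyBounded f = ∃[ c ] ∃[ e ] (∀ k → 1 ℕ.≤ k → f k ℕ.≤ c ℕ.* k ℕ.^ e)

poly-const : ∀ m → PolyBounded (λ _ → m)
poly-const m = m , 0 , λ k _ → ℕ.≤-reflexive (≡.sym (ℕ.*-identityʳ m))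

poly-id : PolyBounded (λ k → k)
poly-id = 1 , 1 , λ k _ → ℕ.≤-reflexive (≡.sym (≡.trans (ℕ.*-identityˡ (k ℕ.^ 1)) (ℕ.^-identityʳ k)))

poly-* : ∀ {f g} → PolyBounded f → PolyBounded g → PolyBounded (λ k → f k ℕ.* g k)
poly-* (c , e , f≤) (c′ , e′ , g≤) = c ℕ.* c′ , e ℕ.+ e′ , λ k 1≤k →
  ℕ.≤-trans (ℕ.*-mono-≤ (f≤ k 1≤k) (g≤ k 1≤k)) (ℕ.≤-reflexive
    (≡.trans (ℕ-*-interchange c (k ℕ.^ e) c′ (k ℕ.^ e′)) (≡.cong (c ℕ.* c′ ℕ.*_) (≡.sym (ℕ.^-distribˡ-+-* k e e′)))))

poly-+ : ∀ {f g} → PolyBounded f → PolyBounded g → PolyBounded (λ k → f k ℕ.+ g k)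
poly-+ (c , e , f≤) (c′ , e′ , g≤) = c ℕ.+ c′ , e ℕ.+ e′ , λ k 1≤k →
  ℕ.≤-trans (ℕ.+-mono-≤
      (ℕ.≤-trans (f≤ k 1≤k) (ℕ.*-monoʳ-≤ c (ℕ.^-monoʳ-≤ k {{ℕ.>-nonZero 1≤k}} (ℕ.m≤m+n e e′))))
      (ℕ.≤-trans (g≤ k 1≤k) (ℕ.*-monoʳ-≤ c′ (ℕ.^-monoʳ-≤ k {{ℕ.>-nonZero 1≤k}} (ℕ.m≤n+m e′ e)))))
    (ℕ.≤-reflexive (≡.sym (ℕ.*-distribʳ-+ (k ℕ.^ (e ℕ.+ e′)) c c′)))

poly-κ : PolyBounded κ
poly-κ = poly-* (poly-* poly-id poly-id) (poly-* poly-id poly-id)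

poly-ρ : PolyBounded ρ
poly-ρ = poly-* (poly-* (poly-* poly-id poly-id) poly-id) (poly-* poly-id poly-id)

poly-2k : PolyBounded (2 ℕ.*_)
poly-2k = poly-* (poly-const 2) poly-id

poly-ε₀ : PolyBounded ε₀
poly-ε₀ = poly-* poly-2k (poly-* poly-id poly-id)

poly-ε₁ : PolyBounded ε₁
poly-ε₁ = poly-* poly-ρ (poly-* poly-ε₀ poly-ε₀)

poly-ε₂ : PolyBounded ε₂
poly-ε₂ = poly-* (poly-* poly-ρ (poly-* poly-ε₁ poly-ε₁)) (poly-+ (poly-const 1) (poly-* poly-κ poly-ε₁))

poly-ε₃ : PolyBounded ε₃
poly-ε₃ = poly-+ (poly-+ (poly-const 1) poly-ε₀) (poly-+ poly-ε₂ (poly-+ sum (poly-* sum poly-ε₂)))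
  where
  sum : PolyBounded (λ k → ρ k ℕ.* (ε₂ k ℕ.* ε₂ k))
  sum = poly-* poly-ρ (poly-* poly-ε₂ poly-ε₂)

poly-threshold : PolyBounded threshold
poly-threshold = poly-+ poly-ε₂ (poly-* (poly-* poly-2k poly-2k) (poly-* poly-κ poly-ε₃))

-- Opaque, so that the constants are never evaluated.
opaque
  poly-σ : PolyBounded σ
  poly-σ = poly-+ (poly-const 1) (poly-* poly-κ (poly-* suc-ε₂ suc-ε₂))
    where
    suc-ε₂ : PolyBounded (λ k → suc (ε₂ k))
    suc-ε₂ = poly-+ (poly-const 1) poly-ε₂

  poly-τ : PolyBounded τ
  poly-τ = poly-+ (poly-* (poly-const 2) poly-threshold) (poly-* poly-2k poly-id)

-- Sumsets of finite subsets of a ring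

module SumSets {c ℓ} (D : Ring c ℓ) (_≟_ : Decidable (Ring._≈_ D)) where
  open Ring D
  open FiniteSubsets D _≟_
  open Algebra.Properties.Ring D
    using (-‿+-comm; -‿distribˡ-*; -‿involutive; x[y-z]≈xy-xz)
  open Algebra.Properties.AbelianGroup +-abelianGroup using ()
    renaming (⁻¹-anti-homo‿- to -‿anti-homo‿-; //-rightDividesˡ to x-y+y≈x)
  open Algebra.Properties.CommutativeSemigroup +-commutativeSemigroup using ()
    renaming (interchange to +-interchange; xy∙z≈xz∙y to swapʳ)
  module ≈-Reasoning = Relation.Binary.Reasoning.Setoid setoid

  infix 4 _∈?_
  infixl 6 _⊖_

  private
    variable
      U V W : FinSubset

  decSetoid : DecSetoid c ℓ
  decSetoid = record { isDecEquivalence = record { isEquivalence = isEquivalence ; _≟_ = _≟_ } }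

  _∈?_ : Decidable _∈_
  x ∈? U = Any.any? (x ≟_) U

  _⊖_ : FinSubset → FinSubset → FinSubset
  _⊖_ = cartesianProductWith _-_

  -- Identities in the additive group

  sum-of-differences : ∀ w x y z → (w - x) + (y - z) ≈ (w + y) - (x + z)
  sum-of-differences w x y z = trans (+-interchange w (- x) y (- z)) (+-congˡ (-‿+-comm x z))

  x+z-[y+z]≈x-y : ∀ x y z → (x + z) - (y + z) ≈ x - y
  x+z-[y+z]≈x-y x y z = begin
    (x + z) - (y + z)  ≈⟨ sum-of-differences x y z z ⟨
    (x - y) + (z - z)  ≈⟨ +-congˡ (-‿inverseʳ z) ⟩
    (x - y) + 0#       ≈⟨ +-identityʳ _ ⟩
    x - y              ∎
    where open ≈-Reasoning

  minus-cong : ∀ {x y u v} → x ≈ y → u ≈ v → x - u ≈ y - v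
  minus-cong x≈y u≈v = +-cong x≈y (-‿cong u≈v)

  x+y≈z+w⇒x-z≈w-y : ∀ {x y z w} → x + y ≈ z + w → x - z ≈ w - y
  x+y≈z+w⇒x-z≈w-y {x} {y} {z} {w} eq = begin
    x - z              ≈⟨ x+z-[y+z]≈x-y x z y ⟨
    (x + y) - (z + y)  ≈⟨ minus-cong (trans eq (+-comm z w)) (+-comm z y) ⟩
    (w + z) - (y + z)  ≈⟨ x+z-[y+z]≈x-y w y z ⟩
    w - y              ∎
    where open ≈-Reasoning

  x+y≈z+w⇒x≈w-y+z : ∀ {x y z w} → x + y ≈ z + w → x ≈ (w - y) + z
  x+y≈z+w⇒x≈w-y+z {x} {y} {z} {w} eq = begin
    x            ≈⟨ x-y+y≈x z x ⟨
    (x - z) + z  ≈⟨ +-congʳ (x+y≈z+w⇒x-z≈w-y eq) ⟩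
    (w - y) + z  ∎
    where open ≈-Reasoning

  +-cancelʳ : ∀ {x y} z → x + z ≈ y + z → x ≈ y
  +-cancelʳ {x} {y} z eq = begin
    x                  ≈⟨ x-y+y≈x z x ⟨
    (x - z) + z        ≈⟨ +-congʳ (x+y≈z+w⇒x-z≈w-y (trans eq (+-comm y z))) ⟩
    (y - z) + z        ≈⟨ x-y+y≈x z y ⟩
    y                  ∎
    where open ≈-Reasoning

  -- Membership

  ∈-resp : ∀ {x y} → x ≈ y → x ∈ U → y ∈ U
  ∈-resp = Membership.∈-resp-≈ setoid

  ∈-[]⁻ : ∀ {x y} → y ∈ x ∷ [] → y ≈ x
  ∈-[]⁻ (here y≈x) = y≈x

  ∈-image⁺ : ∀ {f} → f Preserves _≈_ ⟶ _≈_ → ∀ {x} → x ∈ U → f x ∈ map f U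
  ∈-image⁺ f-cong x∈ = Membership.∈-map⁺ setoid setoid f-cong x∈

  ∈-image⁻ : ∀ {f x} → x ∈ map f U → ∃[ u ] (u ∈ U × x ≈ f u)
  ∈-image⁻ x∈ = Membership.∈-map⁻ setoid setoid x∈

  module _ {f : Carrier → Carrier → Carrier} (f-cong : f Preserves₂ _≈_ ⟶ _≈_ ⟶ _≈_) where
    ∈-image₂⁺ : ∀ {x y} → x ∈ U → y ∈ V → f x y ∈ cartesianProductWith f U V
    ∈-image₂⁺ x∈ y∈ = Membership.∈-cartesianProductWith⁺ setoid setoid setoid f-cong x∈ y∈

  ∈-image₂⁻ : ∀ f U V {z} → z ∈ cartesianProductWith f U V →
              ∃[ x ] ∃[ y ] (x ∈ U × y ∈ V × z ≈ f x y)
  ∈-image₂⁻ = Membership.∈-cartesianProductWith⁻ setoid setoid setoid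

  ∈-⊕⁺ : ∀ {x y} → x ∈ U → y ∈ V → x + y ∈ U ⊕ V
  ∈-⊕⁺ = ∈-image₂⁺ +-cong

  ∈-⊖⁺ : ∀ {x y} → x ∈ U → y ∈ V → x - y ∈ U ⊖ V
  ∈-⊖⁺ = ∈-image₂⁺ minus-cong

  ∈-⊗⁺ : ∀ {x y} → x ∈ U → y ∈ V → x * y ∈ U ⊗ V
  ∈-⊗⁺ = ∈-image₂⁺ *-cong

  ⊕-mono : ∀ {U′ V′} → U ⊆ U′ → V ⊆ V′ → U ⊕ V ⊆ U′ ⊕ V′
  ⊕-mono U⊆ V⊆ z∈ = let x , y , x∈ , y∈ , z≈ = ∈-image₂⁻ _+_ _ _ z∈ in
    ∈-resp (sym z≈) (∈-⊕⁺ (U⊆ x∈) (V⊆ y∈))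

  module _ {P : Pred Carrier p} (P? : Unary.Decidable P) (resp : P Respects _≈_) where
    ∈-filter⁺ : ∀ {x} → x ∈ U → P x → x ∈ filter P? U
    ∈-filter⁺ x∈ Px = Membership.∈-filter⁺ setoid P? resp x∈ Px

    ∈-filter⁻ : ∀ {x} → x ∈ filter P? U → x ∈ U × P x
    ∈-filter⁻ x∈ = Membership.∈-filter⁻ setoid P? resp x∈

  ∈-deduplicate⁺ : ∀ {x} → x ∈ U → x ∈ deduplicate _≟_ U
  ∈-deduplicate⁺ x∈ = Membership.∈-deduplicate⁺ setoid _≟_ (λ y≈z x≈y → trans x≈y (sym y≈z)) x∈

  ∈-deduplicate⁻ : ∀ {x} → x ∈ deduplicate _≟_ U → x ∈ U
  ∈-deduplicate⁻ {U} = Membership.∈-deduplicate⁻ setoid _≟_ U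

  -- Cardinality

  deduplicate-unique : ∀ U → Unique setoid (deduplicate _≟_ U)
  deduplicate-unique = deduplicate-! decSetoid

  length-mono-⊆ : Unique setoid U → U ⊆ V → length U ℕ.≤ length V
  length-mono-⊆ U! U⊆V = length-mono-map setoid setoid id U! U⊆V (λ _ _ x≈y → x≈y)

  card-injection : ∀ f → (∀ {x} → x ∈ U → f x ∈ V) →
                   (∀ {x y} → f x ≈ f y → x ≈ y) → ∣ U ∣ ℕ.≤ ∣ V ∣
  card-injection {U} f f∈ inj = length-mono-map setoid setoid f (deduplicate-unique U)
    (∈-deduplicate⁺ ∘ f∈ ∘ ∈-deduplicate⁻) (λ _ _ → inj)

  card-mono : U ⊆ V → ∣ U ∣ ℕ.≤ ∣ V ∣
  card-mono U⊆V = card-injection id U⊆V id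

  card≤length : ∀ U → ∣ U ∣ ℕ.≤ length U
  card≤length U = length-mono-⊆ (deduplicate-unique U) ∈-deduplicate⁻

  length≤card : Unique setoid U → length U ℕ.≤ ∣ U ∣
  length≤card U! = length-mono-⊆ U! ∈-deduplicate⁺

  ∈⇒card>0 : ∀ {x} → x ∈ U → 0 ℕ.< ∣ U ∣
  ∈⇒card>0 x∈U = Membership.∈-length setoid (∈-deduplicate⁺ x∈U)

  card>0⇒∈ : 0 ℕ.< ∣ U ∣ → ∃[ x ] x ∈ U
  card>0⇒∈ {x ∷ U} _ = x , here refl

  card-∪ : (∀ {x} → x ∈ U → x ∈ V ⊎ x ∈ W) → ∣ U ∣ ℕ.≤ ∣ V ∣ ℕ.+ ∣ W ∣
  card-∪ {U} {V} {W} U⊆ = ℕ.≤-trans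
    (length-mono-⊆ (deduplicate-unique U) λ x∈ → case (U⊆ (∈-deduplicate⁻ x∈)))
    (ℕ.≤-reflexive (length-++ (deduplicate _≟_ V)))
    where
    case : ∀ {x} → x ∈ V ⊎ x ∈ W → x ∈ deduplicate _≟_ V ++ deduplicate _≟_ W
    case (inj₁ x∈) = Membership.∈-++⁺ˡ setoid (∈-deduplicate⁺ x∈)
    case (inj₂ x∈) = Membership.∈-++⁺ʳ setoid _ (∈-deduplicate⁺ x∈)

  card-disjoint : U ⊆ W → V ⊆ W → (∀ {x} → x ∈ U → x ∈ V → ⊥) →
                  ∣ U ∣ ℕ.+ ∣ V ∣ ℕ.≤ ∣ W ∣
  card-disjoint {U} {W} {V} U⊆W V⊆W U#V = ℕ.≤-trans
    (ℕ.≤-reflexive (≡.sym (length-++ (deduplicate _≟_ U))))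
    (length-mono-⊆
      (Unique.++⁺ setoid (deduplicate-unique U) (deduplicate-unique V)
        (λ (x∈U , x∈V) → U#V (∈-deduplicate⁻ x∈U) (∈-deduplicate⁻ x∈V)))
      (λ x∈ → [ ∈-deduplicate⁺ ∘ U⊆W ∘ ∈-deduplicate⁻ , ∈-deduplicate⁺ ∘ V⊆W ∘ ∈-deduplicate⁻ ]′
                (Membership.∈-++⁻ setoid (deduplicate _≟_ U) x∈)))

  card-image : ∀ f → f Preserves _≈_ ⟶ _≈_ → ∀ U → ∣ map f U ∣ ℕ.≤ ∣ U ∣
  card-image f f-cong U = ℕ.≤-trans
    (length-mono-⊆ (deduplicate-unique (map f U)) λ y∈ →
      let x , x∈ , y≈ = ∈-image⁻ (∈-deduplicate⁻ y∈)
      in ∈-resp (sym y≈) (∈-image⁺ f-cong (∈-deduplicate⁺ x∈)))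
    (ℕ.≤-reflexive (length-map f (deduplicate _≟_ U)))

  card-image₂ : ∀ f → f Preserves₂ _≈_ ⟶ _≈_ ⟶ _≈_ → ∀ U V →
                ∣ cartesianProductWith f U V ∣ ℕ.≤ ∣ U ∣ ℕ.* ∣ V ∣
  card-image₂ f f-cong U V = ℕ.≤-trans
    (length-mono-⊆ (deduplicate-unique (cartesianProductWith f U V)) λ z∈ →
      let x , y , x∈ , y∈ , z≈ = ∈-image₂⁻ f U V (∈-deduplicate⁻ z∈)
      in ∈-resp (sym z≈) (∈-image₂⁺ f-cong (∈-deduplicate⁺ x∈) (∈-deduplicate⁺ y∈)))
    (ℕ.≤-reflexive (length-cartesianProductWith f (deduplicate _≟_ U) (deduplicate _≟_ V)))

  card-injection₂ : ∀ (f : Carrier → Carrier → Carrier) → (∀ {x y} → x ∈ U → y ∈ V → f x y ∈ W) →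
                    (∀ {x y x′ y′} → x ∈ U → y ∈ V → x′ ∈ U → y′ ∈ V → f x y ≈ f x′ y′ → x ≈ x′ × y ≈ y′) →
                    ∣ U ∣ ℕ.* ∣ V ∣ ℕ.≤ ∣ W ∣
  card-injection₂ {U} {V} {W} f f∈ inj = ℕ.≤-trans
    (ℕ.≤-reflexive (≡.sym (length-cartesianProduct (deduplicate _≟_ U) (deduplicate _≟_ V))))
    (length-mono-map (setoid ×ₛ setoid) setoid (λ xy → f (proj₁ xy) (proj₂ xy))
      (Unique.cartesianProduct⁺ setoid setoid (deduplicate-unique U) (deduplicate-unique V))
      (λ xy∈ → ∈-deduplicate⁺ (f∈ (proj₁ (split xy∈)) (proj₂ (split xy∈))))
      (λ p q → inj (proj₁ (split p)) (proj₂ (split p)) (proj₁ (split q)) (proj₂ (split q))))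
    where
    open Data.List.Membership.Setoid (setoid ×ₛ setoid) using () renaming (_∈_ to _∈₂_)

    split : ∀ {xy} → xy ∈₂ cartesianProduct (deduplicate _≟_ U) (deduplicate _≟_ V) →
            proj₁ xy ∈ U × proj₂ xy ∈ V
    split xy∈ = let x∈ , y∈ = Membership.∈-cartesianProduct⁻ setoid setoid (deduplicate _≟_ U) (deduplicate _≟_ V) xy∈
      in ∈-deduplicate⁻ x∈ , ∈-deduplicate⁻ y∈

  card-≥⇒⊇ : U ⊆ V → ∣ V ∣ ℕ.≤ ∣ U ∣ → V ⊆ U
  card-≥⇒⊇ {U} {V} U⊆V V≤U {x} x∈V with x ∈? U
  ... | yes x∈U = x∈U
  ... | no  x∉U = ⊥-elim (ℕ.1+n≰n (ℕ.≤-trans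
        (card-disjoint {x ∷ []} {V = U} (λ y∈x → ∈-resp (sym (∈-[]⁻ y∈x)) x∈V) U⊆V
          (λ y∈x y∈U → x∉U (∈-resp (∈-[]⁻ y∈x) y∈U))) V≤U))

  -- The injection (w , u - v) ↦ (u + w , v + w) behind Ruzsa's triangle
  -- inequality needs one representation per difference.
  module _ (U V W : FinSubset) where
    private
      difference : Carrier × Carrier → Carrier
      difference (u , v) = u - v

      differences : DecSetoid c ℓ
      differences = On.decSetoid decSetoid difference

      open DecSetoid differences using () renaming (_≟_ to _≟ᵈ_; setoid to setoidᵈ)
      open Data.List.Membership.Setoid setoidᵈ using () renaming (_∈_ to _∈ᵈ_)
      open Data.List.Membership.Setoid (setoid ×ₛ setoid) using () renaming (_∈_ to _∈²_)

      representatives : List (Carrier × Carrier)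
      representatives = deduplicate _≟ᵈ_ (cartesianProduct U V)

      representatives-length : ∣ U ⊖ V ∣ ℕ.≤ length representatives
      representatives-length = length-mono-injective (λ w uv → w ≈ difference uv) {ys = representatives}
        (AllPairs-map∈ (λ _ _ x≉y x≈ y≈ → x≉y (trans x≈ (sym y≈))) (deduplicate-unique (U ⊖ V)))
        (All.tabulate λ w∈ →
          let u , v , u∈ , v∈ , w≈ = ∈-image₂⁻ _-_ U V (∈-deduplicate⁻ (Any.map reflexive w∈))
              uv∈ = Membership.∈-deduplicate⁺ setoidᵈ _≟ᵈ_ (λ y≈z x≈y → trans x≈y (sym y≈z))
                      (Any.map (λ (u≈ , v≈) → minus-cong u≈ v≈) (Membership.∈-cartesianProduct⁺ setoid setoid u∈ v∈))
          in Any.map (trans w≈) uv∈)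

      representative∈ : ∀ {uv} → uv Propositional.∈ representatives → proj₁ uv ∈ U × proj₂ uv ∈ V
      representative∈ uv∈ =
        let u∈ , v∈ = Propositional.∈-cartesianProduct⁻ U V (Propositional.∈-deduplicate⁻ _≟ᵈ_ _ uv∈)
        in Any.map reflexive u∈ , Any.map reflexive v∈

    ruzsa-triangle : ∣ W ∣ ℕ.* ∣ U ⊖ V ∣ ℕ.≤ ∣ U ⊕ W ∣ ℕ.* ∣ V ⊕ W ∣
    ruzsa-triangle = ℕ.≤-trans (ℕ.*-monoʳ-≤ ∣ W ∣ representatives-length)
      (≡.subst₂ ℕ._≤_ (length-cartesianProduct (deduplicate _≟_ W) representatives)
        (length-cartesianProduct (deduplicate _≟_ (U ⊕ W)) (deduplicate _≟_ (V ⊕ W)))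
        (length-mono-injective (λ (w , u , v) (s , t) → u + w ≈ s × v + w ≈ t)
          -- The two coordinates of the image determine `u - v`, hence the chosen pair `(u , v)`
          -- itself, hence `w`.
          (AllPairs-map∈ (λ x∈ y∈ x≉y (eq₁ , eq₂) (eq₃ , eq₄) →
              let uv≈ = difference-determined eq₁ eq₂ eq₃ eq₄
              in x≉y (summand-determined eq₁ eq₃ (representative-unique x∈ y∈ uv≈) , uv≈))
            (Unique.cartesianProduct⁺ setoid setoidᵈ (deduplicate-unique W)
              (deduplicate-! differences (cartesianProduct U V))))
          (All.tabulate λ {(w , uv)} wuv∈ →
            let w∈ , uv∈ = Propositional.∈-cartesianProduct⁻ (deduplicate _≟_ W) representatives wuv∈
                u∈ , v∈ = representative∈ uv∈
                w∈W = ∈-deduplicate⁻ {W} (Any.map reflexive w∈)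
            in Membership.∈-cartesianProduct⁺ setoid setoid
                 (∈-deduplicate⁺ (∈-⊕⁺ u∈ w∈W)) (∈-deduplicate⁺ (∈-⊕⁺ v∈ w∈W)))))
      where
      representatives-unique : Unique setoidᵈ representatives
      representatives-unique = deduplicate-! differences (cartesianProduct U V)

      representative-unique : ∀ {w w′ uv uv′} →
        (w , uv) Propositional.∈ cartesianProduct (deduplicate _≟_ W) representatives →
        (w′ , uv′) Propositional.∈ cartesianProduct (deduplicate _≟_ W) representatives →
        difference uv ≈ difference uv′ → uv ≡ uv′
      representative-unique p q = ∈-Unique⇒≡ setoidᵈ representatives-unique
        (proj₂ (Propositional.∈-cartesianProduct⁻ (deduplicate _≟_ W) representatives p))
        (proj₂ (Propositional.∈-cartesianProduct⁻ (deduplicate _≟_ W) representatives q))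

      difference-determined : ∀ {w w′ u u′ v v′ s t} → u + w ≈ s → v + w ≈ t → u′ + w′ ≈ s → v′ + w′ ≈ t →
                u - v ≈ u′ - v′
      difference-determined {w} {w′} {u} {u′} {v} {v′} {s} {t} eq₁ eq₂ eq₃ eq₄ = begin
        u - v                  ≈⟨ x+z-[y+z]≈x-y u v w ⟨
        (u + w) - (v + w)      ≈⟨ minus-cong (trans eq₁ (sym eq₃)) (trans eq₂ (sym eq₄)) ⟩
        (u′ + w′) - (v′ + w′)  ≈⟨ x+z-[y+z]≈x-y u′ v′ w′ ⟩
        u′ - v′                ∎
        where open ≈-Reasoning

      summand-determined : ∀ {w w′ s} {uv uv′ : Carrier × Carrier} →
        proj₁ uv + w ≈ s → proj₁ uv′ + w′ ≈ s → uv ≡ uv′ → w ≈ w′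
      summand-determined {w} {w′} {s} {u , _} eq₁ eq₃ ≡.refl = +-cancelʳ u (begin
        w + u   ≈⟨ +-comm w u ⟩
        u + w   ≈⟨ trans eq₁ (sym eq₃) ⟩
        u + w′  ≈⟨ +-comm u w′ ⟩
        w′ + u  ∎)
        where open ≈-Reasoning

  -- Ruzsa's covering lemma

  private
    Apart : FinSubset → Rel Carrier (c ⊔ ℓ)
    Apart V x y = ∀ {v w} → v ∈ V → w ∈ V → x + v ≈ y + w → ⊥

    AllPairs-lookup : ∀ {r} {R : Rel Carrier r} {xs x y} → AllPairs R xs → x Propositional.∈ xs →
                      y Propositional.∈ xs → x ≡ y ⊎ R x y ⊎ R y x
    AllPairs-lookup (_ ∷ _)   (here ≡.refl) (here ≡.refl) = inj₁ ≡.refl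
    AllPairs-lookup (Rx ∷ _)  (here ≡.refl) (there y∈)    = inj₂ (inj₁ (All.lookup Rx y∈))
    AllPairs-lookup (Ry ∷ _)  (there x∈)    (here ≡.refl) = inj₂ (inj₂ (All.lookup Ry x∈))
    AllPairs-lookup (_ ∷ Rxs) (there x∈)    (there y∈)    = AllPairs-lookup Rxs x∈ y∈

    -- Greedy choice. If `u + V` misses all chosen translates, `u` is chosen, and `u = (v - v) + u`
    -- is covered; this is where `V` must be inhabited. Otherwise `u + w = x + w′` for some chosen
    -- `x`, so that `u = (w′ - w) + x`.
    apart-translates : ∀ U V {v} → v ∈ V →
                       ∃[ X ] (X ⊆ U × AllPairs (Apart V) X × U ⊆ (V ⊖ V) ⊕ X)
    apart-translates []      V v∈V = [] , (λ ()) , [] , λ ()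
    apart-translates (u ∷ U) V {v} v∈V with apart-translates U V v∈V
    ... | X , X⊆U , X# , U⊆ with Any.any? (λ x → Any.any? (λ w → (u + w) ∈? map (x +_) V) V) X
    ...   | yes meets = X , there ∘ X⊆U , X# , λ where
            (here y≈u) → ∈-resp (sym y≈u) u∈
            (there y∈) → U⊆ y∈
      where
      u∈ : u ∈ (V ⊖ V) ⊕ X
      u∈ = let x , x∈ , at-x = Propositional.find meets
               w , w∈ , u+w∈ = Propositional.find at-x
               w′ , w′∈ , eq = ∈-image⁻ u+w∈
           in ∈-resp (sym (x+y≈z+w⇒x≈w-y+z eq))
                (∈-⊕⁺ (∈-⊖⁺ w′∈ (Any.map reflexive w∈)) (Any.map reflexive x∈))
    ...   | no  apart   = u ∷ X ,
            (λ { (here y≈u) → here y≈u ; (there y∈) → there (X⊆U y∈) }) ,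
            All.map (λ ¬meets {w} {w′} w∈ w′∈ eq → ¬meets
                (Any.map (λ w≈z → ∈-resp (trans (sym eq) (+-congˡ w≈z)) (∈-image⁺ +-congˡ w′∈)) w∈))
              (¬Any⇒All¬ X apart) ∷ X# ,
            λ where
              (here y≈u) → ∈-resp (x+y≈z+w⇒x≈v-v+x v y≈u) (∈-⊕⁺ (∈-⊖⁺ v∈V v∈V) (here refl))
              (there y∈) → ⊕-mono {U = V ⊖ V} {V = X} id there (U⊆ y∈)
      where
      x+y≈z+w⇒x≈v-v+x : ∀ {y} v → y ≈ u → (v - v) + u ≈ y
      x+y≈z+w⇒x≈v-v+x v y≈u = trans (+-congʳ (-‿inverseʳ v)) (trans (+-identityˡ u) (sym y≈u))

  opaque
    -- The chosen translates `x + V` are pairwise disjoint, have `∣ V ∣` elements each and lie in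
    -- `U + V`, which limits their number.
    ruzsa-covering : ∀ U V {v} → v ∈ V →
                     ∃[ X ] (X ⊆ U × length X ℕ.* ∣ V ∣ ℕ.≤ ∣ U ⊕ V ∣ × U ⊆ (V ⊖ V) ⊕ X)
    ruzsa-covering U V v∈V with apart-translates U V v∈V
    ... | X , X⊆U , X# , U⊆ = X , X⊆U , bound , U⊆
      where
      X! : Unique setoid X
      X! = AllPairs-map∈ (λ _ _ x#y x≈y → x#y v∈V v∈V (+-congʳ x≈y)) X#

      same-translate : ∀ {x y v w} → x ∈ X → y ∈ X → v ∈ V → w ∈ V → x + v ≈ y + w → x ≈ y
      same-translate {v = v} {w} x∈ y∈ v∈ w∈ eq with Propositional.find x∈ | Propositional.find y∈
      ... | x′ , x′∈ , x≈x′ | y′ , y′∈ , y≈y′ with AllPairs-lookup X# x′∈ y′∈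
      ...   | inj₁ ≡.refl        = trans x≈x′ (sym y≈y′)
      ...   | inj₂ (inj₁ x′#y′) = ⊥-elim (x′#y′ v∈ w∈ (trans (+-congʳ (sym x≈x′)) (trans eq (+-congʳ y≈y′))))
      ...   | inj₂ (inj₂ y′#x′) = ⊥-elim (y′#x′ w∈ v∈ (trans (+-congʳ (sym y≈y′)) (trans (sym eq) (+-congʳ x≈x′))))

      same-summand : ∀ {x y v w} → x ≈ y → x + v ≈ y + w → v ≈ w
      same-summand {x} {y} {v} {w} x≈y eq = +-cancelʳ x
        (trans (+-comm v x) (trans eq (trans (+-congʳ (sym x≈y)) (+-comm x w))))

      bound : length X ℕ.* ∣ V ∣ ℕ.≤ ∣ U ⊕ V ∣
      bound = ℕ.≤-trans (ℕ.*-monoˡ-≤ ∣ V ∣ (length≤card X!))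
        (card-injection₂ _+_ (λ x∈ v∈ → ∈-⊕⁺ (X⊆U x∈) v∈)
          (λ x∈ v∈ y∈ w∈ eq → let x≈y = same-translate x∈ y∈ v∈ w∈ eq in x≈y , same-summand x≈y eq))

  -- Petridis' lemma and Plünnecke's inequality

  module _ (X A : FinSubset)
           (minimal : ∀ {p} {P : Pred Carrier p} (P? : Unary.Decidable P) →
                      ∣ X ⊕ A ∣ ℕ.* ∣ filter P? X ∣ ℕ.≤ ∣ filter P? X ⊕ A ∣ ℕ.* ∣ X ∣) where

    -- Induction on `C`, one element `t` at a time. Let `Z` consist of the `x` in `X` for which
    -- `x + A + t` already lies in `X + A + C`. Passing from `C` to `t ∷ C` adds at most
    -- `∣ X + A ∣ - ∣ Z + A ∣` elements on the left and at least `∣ X ∣ - ∣ Z ∣` on the right;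
    -- minimality of the ratio of `X`, tested against `Z`, compares these increments.
    petridis : ∀ C → ∣ X ∣ ℕ.* ∣ X ⊕ A ⊕ C ∣ ℕ.≤ ∣ X ⊕ A ∣ ℕ.* ∣ X ⊕ C ∣
    petridis [] = ℕ.≤-trans (ℕ.*-monoʳ-≤ ∣ X ∣ (card-mono {X ⊕ A ⊕ []} {[]} (⊕[]⊆[] {X ⊕ A})))
      (ℕ.≤-trans (ℕ.≤-reflexive (ℕ.*-zeroʳ ∣ X ∣)) ℕ.z≤n)
      where
      ⊕[]⊆[] : ∀ {U} → U ⊕ [] ⊆ []
      ⊕[]⊆[] {U} z∈ with ∈-image₂⁻ _+_ U [] z∈
      ... | _ , _ , _ , () , _
    petridis (t ∷ C) = combine (∣ X ⊕ A ∣) (∣ X ∣) (∣ Z ∣) (∣ Z ⊕ A ∣)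
      (∣ X ⊕ A ⊕ (t ∷ C) ∣) (∣ X ⊕ A ⊕ C ∣) (∣ X ⊕ (t ∷ C) ∣) (∣ X ⊕ C ∣)
      X+A+C≤ X+C≥ (petridis C) (minimal Stays?)
      where
      Stays : Carrier → Set (c ⊔ ℓ)
      Stays x = All (λ a → (x + a) + t ∈ X ⊕ A ⊕ C) A

      Stays? : Unary.Decidable Stays
      Stays? x = All.all? (λ a → (x + a) + t ∈? X ⊕ A ⊕ C) A

      Stays-resp : Stays Respects _≈_
      Stays-resp x≈y = All.map (∈-resp {X ⊕ A ⊕ C} (+-congʳ (+-congʳ x≈y)))

      Z : FinSubset
      Z = filter Stays? X

      X+A+C≤ : ∣ X ⊕ A ⊕ (t ∷ C) ∣ ℕ.+ ∣ Z ⊕ A ∣ ℕ.≤ ∣ X ⊕ A ⊕ C ∣ ℕ.+ ∣ X ⊕ A ∣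
      X+A+C≤ = begin
        ∣ X ⊕ A ⊕ (t ∷ C) ∣ ℕ.+ ∣ Z ⊕ A ∣
          ≤⟨ ℕ.+-monoˡ-≤ ∣ Z ⊕ A ∣ (card-∪ {V = X ⊕ A ⊕ C} {W = map (_+ t) N} cover) ⟩
        ∣ X ⊕ A ⊕ C ∣ ℕ.+ ∣ map (_+ t) N ∣ ℕ.+ ∣ Z ⊕ A ∣      ≡⟨ ℕ.+-assoc ∣ X ⊕ A ⊕ C ∣ _ _ ⟩
        ∣ X ⊕ A ⊕ C ∣ ℕ.+ (∣ map (_+ t) N ∣ ℕ.+ ∣ Z ⊕ A ∣)
          ≤⟨ ℕ.+-monoʳ-≤ ∣ X ⊕ A ⊕ C ∣ (ℕ.+-monoˡ-≤ ∣ Z ⊕ A ∣ (card-image (_+ t) +-congʳ N)) ⟩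
        ∣ X ⊕ A ⊕ C ∣ ℕ.+ (∣ N ∣ ℕ.+ ∣ Z ⊕ A ∣)
          ≤⟨ ℕ.+-monoʳ-≤ ∣ X ⊕ A ⊕ C ∣ (card-disjoint {N} {X ⊕ A} {Z ⊕ A}
            (proj₁ ∘ ∈N⁻) (⊕-mono {Z} {A} {X} (proj₁ ∘ ∈-filter⁻ Stays? Stays-resp {X}) id) (proj₂ ∘ ∈N⁻)) ⟩
        ∣ X ⊕ A ⊕ C ∣ ℕ.+ ∣ X ⊕ A ∣                           ∎
        where
        open ℕ.≤-Reasoning
        N : FinSubset
        N = filter (λ w → ¬? (w ∈? Z ⊕ A)) (X ⊕ A)

        ∉-resp : (λ w → ¬ (w ∈ Z ⊕ A)) Respects _≈_
        ∉-resp x≈y x∉ y∈ = x∉ (∈-resp (sym x≈y) y∈)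

        ∈N⁻ : ∀ {w} → w ∈ N → w ∈ X ⊕ A × ¬ (w ∈ Z ⊕ A)
        ∈N⁻ = ∈-filter⁻ (λ w → ¬? (w ∈? Z ⊕ A)) ∉-resp

        cover : ∀ {w} → w ∈ X ⊕ A ⊕ (t ∷ C) → w ∈ X ⊕ A ⊕ C ⊎ w ∈ map (_+ t) N
        cover w∈ with ∈-image₂⁻ _+_ (X ⊕ A) (t ∷ C) w∈
        ... | s , u , s∈ , there u∈ , w≈ = inj₁ (∈-resp (sym w≈) (∈-⊕⁺ s∈ u∈))
        ... | s , u , s∈ , here u≈t , w≈ with s ∈? Z ⊕ A
        ...   | no  s∉ = inj₂ (∈-resp (sym (trans w≈ (+-congˡ u≈t)))
                  (∈-image⁺ +-congʳ (∈-filter⁺ (λ w → ¬? (w ∈? Z ⊕ A)) ∉-resp s∈ s∉)))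
        ...   | yes s∈Z+A =
                  let z , a , z∈ , a∈ , s≈ = ∈-image₂⁻ _+_ Z A s∈Z+A
                      stays = proj₂ (∈-filter⁻ Stays? Stays-resp {X} z∈)
                  in inj₁ (∈-resp (sym (trans w≈ (+-cong s≈ u≈t)))
                       (All.lookupₛ setoid (λ a≈b → ∈-resp (+-congʳ (+-congˡ a≈b))) stays a∈))

      X+C≥ : ∣ X ⊕ C ∣ ℕ.+ ∣ X ∣ ℕ.≤ ∣ X ⊕ (t ∷ C) ∣ ℕ.+ ∣ Z ∣
      X+C≥ = begin
        ∣ X ⊕ C ∣ ℕ.+ ∣ X ∣                              ≤⟨ ℕ.+-monoʳ-≤ ∣ X ⊕ C ∣ (card-∪ {V = M} {W = Z} split) ⟩
        ∣ X ⊕ C ∣ ℕ.+ (∣ M ∣ ℕ.+ ∣ Z ∣)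
          ≤⟨ ℕ.+-monoʳ-≤ ∣ X ⊕ C ∣ (ℕ.+-monoˡ-≤ ∣ Z ∣
            (card-injection {M} {map (_+ t) M} (_+ t) (∈-image⁺ +-congʳ) (+-cancelʳ t))) ⟩
        ∣ X ⊕ C ∣ ℕ.+ (∣ map (_+ t) M ∣ ℕ.+ ∣ Z ∣)       ≡⟨ ℕ.+-assoc ∣ X ⊕ C ∣ _ _ ⟨
        ∣ X ⊕ C ∣ ℕ.+ ∣ map (_+ t) M ∣ ℕ.+ ∣ Z ∣
          ≤⟨ ℕ.+-monoˡ-≤ ∣ Z ∣ (card-disjoint {X ⊕ C} {X ⊕ (t ∷ C)} {map (_+ t) M}
            (⊕-mono {X} {C} id there) M+t⊆ M+t#) ⟩
        ∣ X ⊕ (t ∷ C) ∣ ℕ.+ ∣ Z ∣                        ∎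
        where
        open ℕ.≤-Reasoning
        New? : Unary.Decidable (λ x → ¬ (x + t ∈ X ⊕ C))
        New? x = ¬? (x + t ∈? X ⊕ C)

        New-resp : (λ x → ¬ (x + t ∈ X ⊕ C)) Respects _≈_
        New-resp x≈y x∉ y∈ = x∉ (∈-resp (+-congʳ (sym x≈y)) y∈)

        M : FinSubset
        M = filter New? X

        split : ∀ {x} → x ∈ X → x ∈ M ⊎ x ∈ Z
        split {x} x∈ with x + t ∈? X ⊕ C
        ... | no  ∉ = inj₁ (∈-filter⁺ New? New-resp x∈ ∉)
        ... | yes ∈X+C with ∈-image₂⁻ _+_ X C ∈X+C
        -- From `x + t = y + u` follows `(x + a) + t = (y + a) + u` for all `a` in `A`: an `x` that
        -- contributes nothing new to `X + C` belongs to `Z`.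
        ...   | y , u , y∈ , u∈ , eq = inj₂ (∈-filter⁺ Stays? Stays-resp x∈
                (All.tabulateₛ setoid λ {a} a∈ →
                  ∈-resp (sym (trans (swapʳ x a t) (trans (+-congʳ eq) (swapʳ y u a)))) (∈-⊕⁺ (∈-⊕⁺ y∈ a∈) u∈)))

        M+t⊆ : map (_+ t) M ⊆ X ⊕ (t ∷ C)
        M+t⊆ w∈ = let x , x∈ , w≈ = ∈-image⁻ w∈ in
          ∈-resp (sym w≈) (∈-⊕⁺ {X} {t ∷ C} (proj₁ (∈-filter⁻ New? New-resp x∈)) (here refl))

        M+t# : ∀ {w} → w ∈ X ⊕ C → w ∈ map (_+ t) M → ⊥
        M+t# w∈ w∈′ = let x , x∈ , w≈ = ∈-image⁻ w∈′ in
          proj₂ (∈-filter⁻ New? New-resp {X} x∈) (∈-resp w≈ w∈)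

      -- The induction step without subtraction: `α z ≤ z′ ξ` amounts to `ξ (α - z′) ≤ α (ξ - z)`,
      -- the comparison of the two increments.
      combine : ∀ α ξ z z′ p p′ q q′ → p ℕ.+ z′ ℕ.≤ p′ ℕ.+ α → q′ ℕ.+ ξ ℕ.≤ q ℕ.+ z →
                ξ ℕ.* p′ ℕ.≤ α ℕ.* q′ → α ℕ.* z ℕ.≤ z′ ℕ.* ξ → ξ ℕ.* p ℕ.≤ α ℕ.* q
      combine α ξ z z′ p p′ q q′ h₁ h₂ ih min = ℕ.+-cancelʳ-≤ (ξ ℕ.* z′) _ _ (begin
        ξ ℕ.* p ℕ.+ ξ ℕ.* z′   ≡⟨ ℕ.*-distribˡ-+ ξ p z′ ⟨
        ξ ℕ.* (p ℕ.+ z′)       ≤⟨ ℕ.*-monoʳ-≤ ξ h₁ ⟩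
        ξ ℕ.* (p′ ℕ.+ α)       ≡⟨ ℕ.*-distribˡ-+ ξ p′ α ⟩
        ξ ℕ.* p′ ℕ.+ ξ ℕ.* α   ≤⟨ ℕ.+-mono-≤ ih (ℕ.≤-reflexive (ℕ.*-comm ξ α)) ⟩
        α ℕ.* q′ ℕ.+ α ℕ.* ξ   ≡⟨ ℕ.*-distribˡ-+ α q′ ξ ⟨
        α ℕ.* (q′ ℕ.+ ξ)       ≤⟨ ℕ.*-monoʳ-≤ α h₂ ⟩
        α ℕ.* (q ℕ.+ z)        ≡⟨ ℕ.*-distribˡ-+ α q z ⟩
        α ℕ.* q ℕ.+ α ℕ.* z    ≤⟨ ℕ.+-monoʳ-≤ (α ℕ.* q) (ℕ.≤-trans min (ℕ.≤-reflexive (ℕ.*-comm z′ ξ))) ⟩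
        α ℕ.* q ℕ.+ ξ ℕ.* z′   ∎)
        where open ℕ.≤-Reasoning

  ⊕-comm-⊆ : ∀ {U V} → U ⊕ V ⊆ V ⊕ U
  ⊕-comm-⊆ {U} {V} z∈ = let u , v , u∈ , v∈ , z≈ = ∈-image₂⁻ _+_ U V z∈ in
    ∈-resp (sym (trans z≈ (+-comm u v))) (∈-⊕⁺ v∈ u∈)

  ⊕-assoc-⊆ : ∀ {U V W} → U ⊕ (V ⊕ W) ⊆ U ⊕ V ⊕ W
  ⊕-assoc-⊆ {U} {V} {W} z∈ with ∈-image₂⁻ _+_ U (V ⊕ W) z∈
  ... | u , s , u∈ , s∈ , z≈ with ∈-image₂⁻ _+_ V W s∈
  ...   | v , w , v∈ , w∈ , s≈ = ∈-resp (sym (trans z≈ (trans (+-congˡ s≈) (sym (+-assoc u v w)))))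
                                   (∈-⊕⁺ (∈-⊕⁺ u∈ v∈) w∈)

  ⊕-assoc-⊇ : ∀ {U V W} → U ⊕ V ⊕ W ⊆ U ⊕ (V ⊕ W)
  ⊕-assoc-⊇ {U} {V} {W} z∈ with ∈-image₂⁻ _+_ (U ⊕ V) W z∈
  ... | s , w , s∈ , w∈ , z≈ with ∈-image₂⁻ _+_ U V s∈
  ...   | u , v , u∈ , v∈ , s≈ = ∈-resp (sym (trans z≈ (trans (+-congʳ s≈) (+-assoc u v w))))
                                   (∈-⊕⁺ u∈ (∈-⊕⁺ v∈ w∈))

  module Plünnecke (A : FinSubset) (k : ℕ) (A≢∅ : 0 ℕ.< ∣ A ∣) (doubling : ∣ A ⊕ A ∣ ℕ.≤ k ℕ.* ∣ A ∣) where

    private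
      opaque
        -- Minimises `∣ X + A ∣ / ∣ X ∣` over the sublists of `A`. Comparison with `A` itself gives
        -- the bound `k`; filtering `X` yields sublists of `A` again, so Petridis' lemma applies to
        -- `X`.
        ratio-minimiser : ∃[ X ] (X ⊆ A × 0 ℕ.< ∣ X ∣ × ∣ X ⊕ A ∣ ℕ.≤ k ℕ.* ∣ X ∣ ×
                            ∀ C → ∣ X ⊕ A ⊕ C ∣ ℕ.≤ k ℕ.* ∣ X ⊕ C ∣)
        ratio-minimiser with minimal-ratio (λ X → ∣ X ⊕ A ∣) ∣_∣ A A≢∅ (sublists A)
        ... | X , X∈ , X≢∅ , minimal = X , (λ {x} → X⊆A {x}) , X≢∅ , X+A≤ , X+A+C≤
          where
          X-sublist : X Sublist.⊆ A
          X-sublist = [ Sublist.⊆-reflexive , ∈-sublists⁻ A ]′ (Any.toSum X∈)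

          X⊆A : X ⊆ A
          X⊆A {x} x∈ with Propositional.find x∈
          ... | y , y∈ , x≈y = Any.map (λ y≡z → trans x≈y (reflexive y≡z)) (Sublist.lookup X-sublist y∈)

          X+A≤ : ∣ X ⊕ A ∣ ℕ.≤ k ℕ.* ∣ X ∣
          X+A≤ = ℕ.*-cancelʳ-≤ _ _ ∣ A ∣ {{ℕ.>-nonZero A≢∅}} (begin
            ∣ X ⊕ A ∣ ℕ.* ∣ A ∣       ≤⟨ minimal (here ≡.refl) ⟩
            ∣ A ⊕ A ∣ ℕ.* ∣ X ∣       ≤⟨ ℕ.*-monoˡ-≤ ∣ X ∣ doubling ⟩
            k ℕ.* ∣ A ∣ ℕ.* ∣ X ∣     ≡⟨ swap k ∣ A ∣ ∣ X ∣ ⟩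
            k ℕ.* ∣ X ∣ ℕ.* ∣ A ∣     ∎)
            where
            open ℕ.≤-Reasoning
            swap : ∀ x y z → x ℕ.* y ℕ.* z ≡ x ℕ.* z ℕ.* y
            swap = solve-∀

          X+A+C≤ : ∀ C → ∣ X ⊕ A ⊕ C ∣ ℕ.≤ k ℕ.* ∣ X ⊕ C ∣
          X+A+C≤ C = ℕ.*-cancelˡ-≤ ∣ X ∣ {{ℕ.>-nonZero X≢∅}} (begin
            ∣ X ∣ ℕ.* ∣ X ⊕ A ⊕ C ∣
              ≤⟨ petridis X A (λ P? → minimal (there
                (∈-sublists⁺ (Sublist.⊆-trans (filter-⊆ P? X) X-sublist)))) C ⟩
            ∣ X ⊕ A ∣ ℕ.* ∣ X ⊕ C ∣         ≤⟨ ℕ.*-monoˡ-≤ ∣ X ⊕ C ∣ X+A≤ ⟩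
            k ℕ.* ∣ X ∣ ℕ.* ∣ X ⊕ C ∣       ≡⟨ rearrange k ∣ X ∣ ∣ X ⊕ C ∣ ⟩
            ∣ X ∣ ℕ.* (k ℕ.* ∣ X ⊕ C ∣)     ∎)
            where
            open ℕ.≤-Reasoning
            rearrange : ∀ x y z → x ℕ.* y ℕ.* z ≡ y ℕ.* (x ℕ.* z)
            rearrange = solve-∀

      X : FinSubset
      X = proj₁ ratio-minimiser

      X⊆A : X ⊆ A
      X⊆A = proj₁ (proj₂ ratio-minimiser)

      X≢∅ : 0 ℕ.< ∣ X ∣
      X≢∅ = proj₁ (proj₂ (proj₂ ratio-minimiser))

      X+A≤ : ∣ X ⊕ A ∣ ℕ.≤ k ℕ.* ∣ X ∣
      X+A≤ = proj₁ (proj₂ (proj₂ (proj₂ ratio-minimiser)))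

      X+A+C≤ : ∀ C → ∣ X ⊕ A ⊕ C ∣ ℕ.≤ k ℕ.* ∣ X ⊕ C ∣
      X+A+C≤ = proj₂ (proj₂ (proj₂ (proj₂ ratio-minimiser)))

      2A+X≤ : ∣ A ⊕ A ⊕ X ∣ ℕ.≤ k ℕ.* k ℕ.* ∣ X ∣
      2A+X≤ = begin
        ∣ A ⊕ A ⊕ X ∣          ≤⟨ card-mono {A ⊕ A ⊕ X} {X ⊕ A ⊕ A} (⊕-assoc-⊆ {X} ∘ ⊕-comm-⊆ {A ⊕ A} {X}) ⟩
        ∣ X ⊕ A ⊕ A ∣          ≤⟨ X+A+C≤ A ⟩
        k ℕ.* ∣ X ⊕ A ∣        ≤⟨ ℕ.*-monoʳ-≤ k X+A≤ ⟩
        k ℕ.* (k ℕ.* ∣ X ∣)    ≡⟨ ℕ.*-assoc k k ∣ X ∣ ⟨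
        k ℕ.* k ℕ.* ∣ X ∣      ∎
        where open ℕ.≤-Reasoning

      3A+X≤ : ∣ A ⊕ A ⊕ A ⊕ X ∣ ℕ.≤ k ℕ.* k ℕ.* k ℕ.* ∣ X ∣
      3A+X≤ = begin
        ∣ A ⊕ A ⊕ A ⊕ X ∣
          ≤⟨ card-mono {A ⊕ A ⊕ A ⊕ X} {X ⊕ A ⊕ (A ⊕ A)}
            (⊕-assoc-⊆ {X} ∘ ⊕-mono {X} {A ⊕ A ⊕ A} id (⊕-assoc-⊇ {A}) ∘ ⊕-comm-⊆ {A ⊕ A ⊕ A} {X}) ⟩
        ∣ X ⊕ A ⊕ (A ⊕ A) ∣           ≤⟨ X+A+C≤ (A ⊕ A) ⟩
        k ℕ.* ∣ X ⊕ (A ⊕ A) ∣         ≤⟨ ℕ.*-monoʳ-≤ k (card-mono {X ⊕ (A ⊕ A)} {A ⊕ A ⊕ X} (⊕-comm-⊆ {X})) ⟩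
        k ℕ.* ∣ A ⊕ A ⊕ X ∣           ≤⟨ ℕ.*-monoʳ-≤ k 2A+X≤ ⟩
        k ℕ.* (k ℕ.* k ℕ.* ∣ X ∣)     ≡⟨ regroup k ∣ X ∣ ⟩
        k ℕ.* k ℕ.* k ℕ.* ∣ X ∣       ∎
        where
        open ℕ.≤-Reasoning
        regroup : ∀ x y → x ℕ.* (x ℕ.* x ℕ.* y) ≡ x ℕ.* x ℕ.* x ℕ.* y
        regroup = solve-∀

      -- The triangle inequality through `X`: both sums are measured against `∣ X ∣`, and one factor
      -- `∣ X ∣` cancels. Only then is `X` replaced by the larger `A`.
      difference-bound : ∀ U V m m′ → ∣ U ⊕ X ∣ ℕ.≤ m ℕ.* ∣ X ∣ → ∣ V ⊕ X ∣ ℕ.≤ m′ ℕ.* ∣ X ∣ →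
                         ∣ U ⊖ V ∣ ℕ.≤ m ℕ.* m′ ℕ.* ∣ A ∣
      difference-bound U V m m′ U+X≤ V+X≤ = ℕ.≤-trans
        (ℕ.*-cancelˡ-≤ ∣ X ∣ {{ℕ.>-nonZero X≢∅}} (begin
          ∣ X ∣ ℕ.* ∣ U ⊖ V ∣                  ≤⟨ ruzsa-triangle U V X ⟩
          ∣ U ⊕ X ∣ ℕ.* ∣ V ⊕ X ∣              ≤⟨ ℕ.*-mono-≤ U+X≤ V+X≤ ⟩
          (m ℕ.* ∣ X ∣) ℕ.* (m′ ℕ.* ∣ X ∣)     ≡⟨ rearrange m m′ ∣ X ∣ ⟩
          ∣ X ∣ ℕ.* (m ℕ.* m′ ℕ.* ∣ X ∣)       ∎))
        (ℕ.*-monoʳ-≤ (m ℕ.* m′) (card-mono {X} {A} (λ {x} → X⊆A {x})))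
        where
        open ℕ.≤-Reasoning
        rearrange : ∀ x y z → (x ℕ.* z) ℕ.* (y ℕ.* z) ≡ z ℕ.* (x ℕ.* y ℕ.* z)
        rearrange = solve-∀

    2A-2A≤ : ∣ (A ⊕ A) ⊖ (A ⊕ A) ∣ ℕ.≤ κ k ℕ.* ∣ A ∣
    2A-2A≤ = difference-bound (A ⊕ A) (A ⊕ A) (k ℕ.* k) (k ℕ.* k) 2A+X≤ 2A+X≤

    3A-2A≤ : ∣ (A ⊕ A ⊕ A) ⊖ (A ⊕ A) ∣ ℕ.≤ ρ k ℕ.* ∣ A ∣
    3A-2A≤ = difference-bound (A ⊕ A ⊕ A) (A ⊕ A) (k ℕ.* k ℕ.* k) (k ℕ.* k) 3A+X≤ 2A+X≤

    opaque
      -- The covering lemma needs the size of `(2A - 2A) + A`, which rearranges to `3A - 2A`. Since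
      -- `H + H` lies in `2A - 2A`, this is what turns a sum of two translates of `H` back into
      -- translates of a single `H`.
      2A-2A-covered : ∃[ Y ] (length Y ℕ.≤ ρ k × (A ⊕ A) ⊖ (A ⊕ A) ⊆ (A ⊖ A) ⊕ Y)
      2A-2A-covered with card>0⇒∈ {A} A≢∅
      ... | a , a∈A with ruzsa-covering ((A ⊕ A) ⊖ (A ⊕ A)) A a∈A
      ...   | Y , _ , bound , covers = Y , ℕ.*-cancelʳ-≤ _ _ ∣ A ∣ {{ℕ.>-nonZero A≢∅}}
              (ℕ.≤-trans bound (ℕ.≤-trans (card-mono {(A ⊕ A) ⊖ (A ⊕ A) ⊕ A} {(A ⊕ A ⊕ A) ⊖ (A ⊕ A)} regroup) 3A-2A≤)) , λ {x} → covers {x}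
        where
        regroup : (A ⊕ A) ⊖ (A ⊕ A) ⊕ A ⊆ (A ⊕ A ⊕ A) ⊖ (A ⊕ A)
        regroup z∈ with ∈-image₂⁻ _+_ ((A ⊕ A) ⊖ (A ⊕ A)) A z∈
        ... | s , b , s∈ , b∈ , z≈ with ∈-image₂⁻ _-_ (A ⊕ A) (A ⊕ A) s∈
        ...   | u , v , u∈ , v∈ , s≈ = ∈-resp (sym (trans z≈ (trans (+-congʳ s≈) (swapʳ u (- v) b))))
                (∈-⊖⁺ (∈-⊕⁺ u∈ b∈) v∈)

  -- Good elements: `x A` covered by few translates of `A - A`

  module Goodness (A : FinSubset) (k : ℕ) (A≢∅ : 0 ℕ.< ∣ A ∣)
                  (doubling : ∣ A ⊕ A ∣ ℕ.≤ k ℕ.* ∣ A ∣) where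
    open Plünnecke A k A≢∅ doubling

    H : FinSubset
    H = A ⊖ A

    -- Translates are counted by the length of the list, which is exactly multiplicative under `⊕`,
    -- so no repetitions have to be removed.
    Covered : ℕ → FinSubset → Set (c ⊔ ℓ)
    Covered M U = ∃[ T ] (length T ℕ.≤ M × U ⊆ H ⊕ T)

    private
      variable
        M N : ℕ
        x y : Carrier

    covered-mono : M ℕ.≤ N → V ⊆ U → Covered M U → Covered N V
    covered-mono M≤N V⊆U (T , T≤M , U⊆) = T , ℕ.≤-trans T≤M M≤N , λ {x} → U⊆ {x} ∘ V⊆U {x}

    H+H⊆2A-2A : x ∈ H → y ∈ H → x + y ∈ (A ⊕ A) ⊖ (A ⊕ A)
    H+H⊆2A-2A x∈ y∈ with ∈-image₂⁻ _-_ A A x∈ | ∈-image₂⁻ _-_ A A y∈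
    ... | a , b , a∈ , b∈ , x≈ | a′ , b′ , a′∈ , b′∈ , y≈ =
      ∈-resp (sym (trans (+-cong x≈ y≈) (sum-of-differences a b a′ b′))) (∈-⊖⁺ (∈-⊕⁺ a∈ a′∈) (∈-⊕⁺ b∈ b′∈))

    -‿H : x ∈ H → - x ∈ H
    -‿H x∈ with ∈-image₂⁻ _-_ A A x∈
    ... | a , b , a∈ , b∈ , x≈ = ∈-resp (sym (trans (-‿cong x≈) (-‿anti-homo‿- a b))) (∈-⊖⁺ b∈ a∈)

    H-H⊆2A-2A : x ∈ H → y ∈ H → x - y ∈ (A ⊕ A) ⊖ (A ⊕ A)
    H-H⊆2A-2A x∈ y∈ = H+H⊆2A-2A x∈ (-‿H y∈)

    0∈H : 0# ∈ H
    0∈H with card>0⇒∈ {A} A≢∅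
    ... | a , a∈ = ∈-resp (-‿inverseʳ a) (∈-⊖⁺ a∈ a∈)

    opaque
      covered-⊕ : Covered M U → Covered N V → Covered (ρ k ℕ.* (M ℕ.* N)) (U ⊕ V)
      covered-⊕ {M} {U} {N} {V} (T , T≤M , U⊆) (T′ , T′≤N , V⊆) with 2A-2A-covered
      ... | Y , Y≤ρ , 2A-2A⊆ = Y ⊕ (T ⊕ T′) , bound , covers
        where
        bound : length (Y ⊕ (T ⊕ T′)) ℕ.≤ ρ k ℕ.* (M ℕ.* N)
        bound = ℕ.≤-trans (ℕ.≤-reflexive (≡.trans (length-cartesianProductWith _+_ Y (T ⊕ T′))
                            (≡.cong (length Y ℕ.*_) (length-cartesianProductWith _+_ T T′))))
                  (ℕ.*-mono-≤ Y≤ρ (ℕ.*-mono-≤ T≤M T′≤N))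

        covers : U ⊕ V ⊆ H ⊕ (Y ⊕ (T ⊕ T′))
        covers {z} z∈ with ∈-image₂⁻ _+_ U V z∈
        ... | u , v , u∈ , v∈ , z≈ with ∈-image₂⁻ _+_ H T (U⊆ u∈) | ∈-image₂⁻ _+_ H T′ (V⊆ v∈)
        ...   | h , t , h∈ , t∈ , u≈ | h′ , t′ , h′∈ , t′∈ , v≈ with ∈-image₂⁻ _+_ H Y (2A-2A⊆ (H+H⊆2A-2A h∈ h′∈))
        ...     | g , w , g∈ , w∈ , h+h′≈ = ∈-resp (sym eq) (∈-⊕⁺ g∈ (∈-⊕⁺ w∈ (∈-⊕⁺ t∈ t′∈)))
          where
          eq : z ≈ g + (w + (t + t′))
          eq = begin
            z                    ≈⟨ trans z≈ (+-cong u≈ v≈) ⟩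
            (h + t) + (h′ + t′)  ≈⟨ +-interchange h t h′ t′ ⟩
            (h + h′) + (t + t′)  ≈⟨ +-congʳ h+h′≈ ⟩
            (g + w) + (t + t′)   ≈⟨ +-assoc g w (t + t′) ⟩
            g + (w + (t + t′))   ∎
            where open ≈-Reasoning

    opaque
      covered-neg : Covered M U → Covered M (map -_ U)
      covered-neg {M} {U} (T , T≤M , U⊆) = map -_ T , ℕ.≤-trans (ℕ.≤-reflexive (length-map -_ T)) T≤M , covers
        where
        covers : map -_ U ⊆ H ⊕ map -_ T
        covers z∈ with ∈-image⁻ z∈
        ... | u , u∈ , z≈ with ∈-image₂⁻ _+_ H T (U⊆ u∈)
        ...   | h , t , h∈ , t∈ , u≈ = ∈-resp (sym (trans z≈ (trans (-‿cong u≈) (sym (-‿+-comm h t)))))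
                  (∈-⊕⁺ (-‿H h∈) (∈-image⁺ -‿cong t∈))

    -- `A + U` lies in `(A + H) + T`, and subtracting a fixed element of `A` moves `A + H` into
    -- `2A - 2A`.
    card-⊕-covered : Covered M U → ∣ A ⊕ U ∣ ℕ.≤ κ k ℕ.* ∣ A ∣ ℕ.* M
    card-⊕-covered {M} {U} (T , T≤M , U⊆) = ℕ.≤-trans (card-mono {A ⊕ U} {A ⊕ H ⊕ T} (⊕-assoc-⊆ {A} ∘ ⊕-mono {A} id U⊆))
      (ℕ.≤-trans (card-image₂ _+_ +-cong (A ⊕ H) T)
        (ℕ.*-mono-≤ (ℕ.≤-trans A+H≤ 2A-2A≤) (ℕ.≤-trans (card≤length T) T≤M)))
      where
      A+H≤ : ∣ A ⊕ H ∣ ℕ.≤ ∣ (A ⊕ A) ⊖ (A ⊕ A) ∣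
      A+H≤ with card>0⇒∈ {A} A≢∅
      ... | a₀ , a₀∈ = card-injection {A ⊕ H} {(A ⊕ A) ⊖ (A ⊕ A)} (_- a₀) shifted (+-cancelʳ (- a₀))
        where
        shifted : ∀ {z} → z ∈ A ⊕ H → z - a₀ ∈ (A ⊕ A) ⊖ (A ⊕ A)
        shifted z∈ with ∈-image₂⁻ _+_ A H z∈
        ... | a , h , a∈ , h∈ , z≈ = ∈-resp (trans (+-comm h (a - a₀)) (trans (swapʳ a (- a₀) h) (+-congʳ (sym z≈))))
                (H+H⊆2A-2A h∈ (∈-⊖⁺ a∈ a₀∈))

    Good : ℕ → Carrier → Set (c ⊔ ℓ)
    Good M x = Covered M (x ·ˡ A)

    good-mono : M ℕ.≤ N → Good M x → Good N x
    good-mono M≤N = covered-mono M≤N id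

    ·ˡ-congˡ-⊆ : x ≈ y → y ·ˡ U ⊆ x ·ˡ U
    ·ˡ-congˡ-⊆ x≈y z∈ with ∈-image⁻ z∈
    ... | u , u∈ , z≈ = ∈-resp (sym (trans z≈ (*-congʳ (sym x≈y)))) (∈-image⁺ *-congˡ u∈)

    good-resp : x ≈ y → Good M x → Good M y
    good-resp x≈y = covered-mono ℕ.≤-refl (·ˡ-congˡ-⊆ x≈y)

    good-0# : Good 1 0#
    good-0# = 0# ∷ [] , ℕ.≤-refl , λ z∈ →
      let a , a∈ , z≈ = ∈-image⁻ z∈ in
      ∈-resp (sym (trans z≈ (trans (zeroˡ a) (sym (+-identityˡ 0#))))) (∈-⊕⁺ 0∈H (here refl))

    good-+ : Good M x → Good N y → Good (ρ k ℕ.* (M ℕ.* N)) (x + y)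
    good-+ {x = x} {y = y} gx gy = covered-mono ℕ.≤-refl distribute (covered-⊕ gx gy)
      where
      distribute : (x + y) ·ˡ A ⊆ x ·ˡ A ⊕ y ·ˡ A
      distribute z∈ = let a , a∈ , z≈ = ∈-image⁻ z∈ in
        ∈-resp (sym (trans z≈ (distribʳ a x y))) (∈-⊕⁺ (∈-image⁺ *-congˡ a∈) (∈-image⁺ *-congˡ a∈))

    good-neg : Good M x → Good M (- x)
    good-neg {x = x} gx = covered-mono ℕ.≤-refl neg (covered-neg gx)
      where
      neg : (- x) ·ˡ A ⊆ map -_ (x ·ˡ A)
      neg z∈ = let a , a∈ , z≈ = ∈-image⁻ z∈ in
        ∈-resp (sym (trans z≈ (sym (-‿distribˡ-* x a)))) (∈-image⁺ -‿cong (∈-image⁺ *-congˡ a∈))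

    opaque
      covered-·ˡ-H : Good M x → Covered (ρ k ℕ.* (M ℕ.* M)) (x ·ˡ H)
      covered-·ˡ-H {x = x} gx = covered-mono ℕ.≤-refl split (covered-⊕ gx (covered-neg gx))
        where
        split : x ·ˡ H ⊆ x ·ˡ A ⊕ map -_ (x ·ˡ A)
        split z∈ with ∈-image⁻ z∈
        ... | h , h∈ , z≈ with ∈-image₂⁻ _-_ A A h∈
        ...   | a , b , a∈ , b∈ , h≈ = ∈-resp (sym (trans z≈ (trans (*-congˡ h≈) (x[y-z]≈xy-xz x a b))))
                  (∈-⊕⁺ (∈-image⁺ *-congˡ a∈) (∈-image⁺ -‿cong (∈-image⁺ *-congˡ b∈)))

    opaque
      -- `x y A` lies in `x H + x T`. Only `x H`, a part of `x A - x A`, has to be covered anew;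
      -- multiplying `T` by `x` does not change the number of its translates. Hence the bound is
      -- quadratic in `M` but linear in `N`.
      good-* : Good M x → Good N y → Good (ρ k ℕ.* (M ℕ.* M) ℕ.* N) (x * y)
      good-* {M} {x} {N} {y} gx (T , T≤N , yA⊆) = S ⊕ x ·ˡ T , bound , (λ {z} → covers {z})
        where
        xH-covered : Covered (ρ k ℕ.* (M ℕ.* M)) (x ·ˡ H)
        xH-covered = covered-·ˡ-H gx

        S : FinSubset
        S = proj₁ xH-covered

        S≤ : length S ℕ.≤ ρ k ℕ.* (M ℕ.* M)
        S≤ = proj₁ (proj₂ xH-covered)

        xH⊆ : x ·ˡ H ⊆ H ⊕ S
        xH⊆ = proj₂ (proj₂ xH-covered)

        bound : length (S ⊕ x ·ˡ T) ℕ.≤ ρ k ℕ.* (M ℕ.* M) ℕ.* N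
        bound = ℕ.≤-trans (ℕ.≤-reflexive (length-cartesianProductWith _+_ S (x ·ˡ T)))
          (ℕ.*-mono-≤ S≤ (ℕ.≤-trans (ℕ.≤-reflexive (length-map (x *_) T)) T≤N))

        covers : (x * y) ·ˡ A ⊆ H ⊕ (S ⊕ x ·ˡ T)
        covers {z} z∈ with ∈-image⁻ z∈
        ... | a , a∈ , z≈ with ∈-image₂⁻ _+_ H T (yA⊆ (∈-image⁺ *-congˡ a∈))
        ...   | h , t , h∈ , t∈ , ya≈ with ∈-image₂⁻ _+_ H S (xH⊆ (∈-image⁺ *-congˡ h∈))
        ...     | g , s , g∈ , s∈ , xh≈ = ∈-resp (sym eq) (∈-⊕⁺ g∈ (∈-⊕⁺ s∈ (∈-image⁺ *-congˡ t∈)))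
          where
          eq : z ≈ g + (s + x * t)
          eq = begin
            z                 ≈⟨ z≈ ⟩
            (x * y) * a       ≈⟨ *-assoc x y a ⟩
            x * (y * a)       ≈⟨ *-congˡ ya≈ ⟩
            x * (h + t)       ≈⟨ distribˡ x h t ⟩
            x * h + x * t     ≈⟨ +-congʳ xh≈ ⟩
            (g + s) + x * t   ≈⟨ +-assoc g s (x * t) ⟩
            g + (s + x * t)   ∎
            where open ≈-Reasoning

    *-leftInjective : ∀ {b b⁻¹} → b⁻¹ * b ≈ 1# → ∀ {x y} → b * x ≈ b * y → x ≈ y
    *-leftInjective {b} {b⁻¹} inv {x} {y} eq = begin
      x              ≈⟨ *-identityˡ x ⟨
      1# * x         ≈⟨ *-congʳ inv ⟨
      (b⁻¹ * b) * x  ≈⟨ *-assoc b⁻¹ b x ⟩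
      b⁻¹ * (b * x)  ≈⟨ *-congˡ eq ⟩
      b⁻¹ * (b * y)  ≈⟨ *-assoc b⁻¹ b y ⟨
      (b⁻¹ * b) * y  ≈⟨ *-congʳ inv ⟩
      1# * y         ≈⟨ *-identityˡ y ⟩
      y              ∎
      where open ≈-Reasoning

    opaque
      -- Multiplication by `x` carries `y A + A` injectively into `A + x A`, whose size is
      -- controlled by the goodness of `x`; the covering lemma then applies to `y A`.
      good-inverse : Good M x → y * x ≈ 1# → x * y ≈ 1# → Good (κ k ℕ.* M) y
      good-inverse {M} {x} {y} gx yx≈1 xy≈1 with card>0⇒∈ {A} A≢∅
      ... | a₀ , a₀∈ with ruzsa-covering (y ·ˡ A) A a₀∈
      ...   | T , _ , bound , covers = T , ℕ.*-cancelʳ-≤ _ _ ∣ A ∣ {{ℕ.>-nonZero A≢∅}} (ℕ.≤-trans bound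
                (ℕ.≤-trans (card-injection {y ·ˡ A ⊕ A} {A ⊕ x ·ˡ A} (x *_) dilate (*-leftInjective yx≈1))
                  (ℕ.≤-trans (card-⊕-covered gx) (ℕ.≤-reflexive (swap (κ k) ∣ A ∣ M))))) , λ {z} → covers {z}
        where
        swap : ∀ x y z → x ℕ.* y ℕ.* z ≡ x ℕ.* z ℕ.* y
        swap = solve-∀

        dilate : ∀ {z} → z ∈ y ·ˡ A ⊕ A → x * z ∈ A ⊕ x ·ˡ A
        dilate {z} z∈ with ∈-image₂⁻ _+_ (y ·ˡ A) A z∈
        ... | s , b , s∈ , b∈ , z≈ with ∈-image⁻ s∈
        ...   | a , a∈ , s≈ = ∈-resp (sym eq) (∈-⊕⁺ a∈ (∈-image⁺ *-congˡ b∈))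
          where
          eq : x * z ≈ a + x * b
          eq = begin
            x * z                ≈⟨ *-congˡ (trans z≈ (+-congʳ s≈)) ⟩
            x * (y * a + b)      ≈⟨ distribˡ x (y * a) b ⟩
            x * (y * a) + x * b  ≈⟨ +-congʳ (*-assoc x y a) ⟨
            (x * y) * a + x * b  ≈⟨ +-congʳ (trans (*-congʳ xy≈1) (*-identityˡ a)) ⟩
            a + x * b            ∎
            where open ≈-Reasoning

    opaque
      -- Multiplication by `b` carries `β A - A` injectively into `a A - b A`. Covering by
      -- translates of `- A` rather than of `A` produces this difference in place of a sum, at no
      -- cost, as `(- A) - (- A)` is again `H`.
      good-ratio : ∀ {a b b⁻¹ β} m → b⁻¹ * b ≈ 1# → b * β ≈ a →
                   ∣ (a ·ˡ A) ⊖ (b ·ˡ A) ∣ ℕ.≤ m ℕ.* ∣ A ∣ → Good m β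
      good-ratio {a} {b} {b⁻¹} {β} m inv bβ≈a small with card>0⇒∈ {A} A≢∅
      ... | a₀ , a₀∈ with ruzsa-covering (β ·ˡ A) (map -_ A) (∈-image⁺ -‿cong a₀∈)
      ...   | T , _ , bound , covers = T , ℕ.*-cancelʳ-≤ _ _ ∣ A ∣ {{ℕ.>-nonZero A≢∅}} (ℕ.≤-trans
                (ℕ.*-monoʳ-≤ (length T) (card-injection {A} {map -_ A} -_ (∈-image⁺ -‿cong) -‿injective))
                (ℕ.≤-trans bound
                (ℕ.≤-trans (card-injection {β ·ˡ A ⊕ map -_ A} {(a ·ˡ A) ⊖ (b ·ˡ A)} (b *_) dilate (*-leftInjective inv)) small)))
              , λ {z} → ⊕-mono {V = T} negate id ∘ covers {z}
        where
        -‿injective : ∀ {x y} → - x ≈ - y → x ≈ y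
        -‿injective {x} {y} eq = trans (sym (-‿involutive x)) (trans (-‿cong eq) (-‿involutive y))

        negate : map -_ A ⊖ map -_ A ⊆ H
        negate z∈ with ∈-image₂⁻ _-_ (map -_ A) (map -_ A) z∈
        ... | s , t , s∈ , t∈ , z≈ with ∈-image⁻ s∈ | ∈-image⁻ t∈
        ...   | u , u∈ , s≈ | v , v∈ , t≈ = ∈-resp (sym (trans z≈ (trans (minus-cong s≈ t≈)
                  (trans (+-congˡ (-‿involutive v)) (+-comm (- u) v))))) (∈-⊖⁺ v∈ u∈)

        dilate : ∀ {z} → z ∈ β ·ˡ A ⊕ map -_ A → b * z ∈ (a ·ˡ A) ⊖ (b ·ˡ A)
        dilate {z} z∈ with ∈-image₂⁻ _+_ (β ·ˡ A) (map -_ A) z∈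
        ... | s , t , s∈ , t∈ , z≈ with ∈-image⁻ s∈ | ∈-image⁻ t∈
        ...   | u , u∈ , s≈ | v , v∈ , t≈ = ∈-resp (sym eq) (∈-⊖⁺ (∈-image⁺ *-congˡ u∈) (∈-image⁺ *-congˡ v∈))
          where
          eq : b * z ≈ a * u - b * v
          eq = begin
            b * z              ≈⟨ *-congˡ (trans z≈ (+-cong s≈ t≈)) ⟩
            b * (β * u - v)    ≈⟨ x[y-z]≈xy-xz b (β * u) v ⟩
            b * (β * u) - b * v ≈⟨ +-congʳ (*-assoc b β u) ⟨
            (b * β) * u - b * v ≈⟨ +-congʳ (*-congʳ bβ≈a) ⟩
            a * u - b * v      ∎
            where open ≈-Reasoning

  -- Multiplicative energy and popular dilates

  2xy≤xx+yy : ∀ x y → 2 ℕ.* (x ℕ.* y) ℕ.≤ x ℕ.* x ℕ.+ y ℕ.* y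
  2xy≤xx+yy zero    y       = ℕ.z≤n
  2xy≤xx+yy (suc x) zero    = ≡.subst (ℕ._≤ suc x ℕ.* suc x ℕ.+ 0) (≡.sym (≡.cong (2 ℕ.*_) (ℕ.*-zeroʳ x))) ℕ.z≤n
  2xy≤xx+yy (suc x) (suc y) = ≡.subst₂ ℕ._≤_ (lhs x y) (rhs x y) (ℕ.+-monoˡ-≤ (2 ℕ.* (x ℕ.+ y ℕ.+ 1)) (2xy≤xx+yy x y))
    where
    lhs : ∀ x y → 2 ℕ.* (x ℕ.* y) ℕ.+ 2 ℕ.* (x ℕ.+ y ℕ.+ 1) ≡ 2 ℕ.* ((1 ℕ.+ x) ℕ.* (1 ℕ.+ y))
    lhs = solve-∀
    rhs : ∀ x y → x ℕ.* x ℕ.+ y ℕ.* y ℕ.+ 2 ℕ.* (x ℕ.+ y ℕ.+ 1) ≡ (1 ℕ.+ x) ℕ.* (1 ℕ.+ x) ℕ.+ (1 ℕ.+ y) ℕ.* (1 ℕ.+ y)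
    rhs = solve-∀

  am-gm : ∀ k n r → 2 ℕ.* k ℕ.* n ℕ.* r ℕ.≤ k ℕ.* k ℕ.* (r ℕ.* r) ℕ.+ n ℕ.* n
  am-gm k n r = ≡.subst₂ ℕ._≤_ (lhs k n r) (rhs k n r) (2xy≤xx+yy (k ℕ.* r) n)
    where
    lhs : ∀ k n r → 2 ℕ.* (k ℕ.* r ℕ.* n) ≡ 2 ℕ.* k ℕ.* n ℕ.* r
    lhs = solve-∀
    rhs : ∀ k n r → k ℕ.* r ℕ.* (k ℕ.* r) ℕ.+ n ℕ.* n ≡ k ℕ.* k ℕ.* (r ℕ.* r) ℕ.+ n ℕ.* n
    rhs = solve-∀

  module PopularDilates (A : FinSubset) (k : ℕ) (A≢∅ : 0 ℕ.< ∣ A ∣)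
                        (cancel : ∀ {a x y} → a ∈ A → a * x ≈ a * y → x ≈ y)
                        (A⊗A≤ : ∣ A ⊗ A ∣ ℕ.≤ k ℕ.* ∣ A ∣) where

    L P : FinSubset
    L = deduplicate _≟_ A
    P = deduplicate _≟_ (A ⊗ A)

    n : ℕ
    n = ∣ A ∣

    ∈ₚL⇒∈A : ∀ {a} → a Propositional.∈ L → a ∈ A
    ∈ₚL⇒∈A a∈ = ∈-deduplicate⁻ (Any.map reflexive a∈)

    β : Carrier → Carrier → ℕ
    β a = indicator (_∈? a ·ˡ A)

    row : ∀ {a} → a Propositional.∈ L → n ℕ.≤ ∑ P (β a)
    row {a} a∈ = ≡.subst (n ℕ.≤_) (≡.sym (∑-indicator (_∈? a ·ˡ A) P))
      (length-mono-map setoid setoid (a *_) (deduplicate-unique A)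
        (λ x∈ → let x∈A = ∈-deduplicate⁻ x∈ in
          ∈-filter⁺ (_∈? a ·ˡ A) ∈-resp (∈-deduplicate⁺ (∈-⊗⁺ (∈ₚL⇒∈A a∈) x∈A)) (∈-image⁺ *-congˡ x∈A))
        (λ _ _ → cancel (∈ₚL⇒∈A a∈)))

    -- By cancellation, the number of representations of `z` as a product of two elements of `A`;
    -- the sum `E` of its squares below is the multiplicative energy of `A`.
    rep : Carrier → ℕ
    rep z = ∑[ a ∈ L ] β a z

    n*n≤∑rep : n ℕ.* n ℕ.≤ ∑ P rep
    n*n≤∑rep = begin
      n ℕ.* n                  ≡⟨ ∑-const L n ⟨
      ∑[ a ∈ L ] n             ≤⟨ ∑-mono L row ⟩
      ∑[ a ∈ L ] ∑ P (β a)     ≡⟨ ∑-swap L P β ⟩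
      ∑ P rep                  ∎
      where open ℕ.≤-Reasoning

    E : ℕ
    E = ∑[ z ∈ P ] (rep z ℕ.* rep z)

    -- Cauchy–Schwarz, in the form 2 (k n) r ≤ (k r)² + n² summed over P.
    opaque
      energy : n ℕ.* (k ℕ.* (n ℕ.* n)) ℕ.≤ k ℕ.* k ℕ.* E
      energy = ℕ.+-cancelʳ-≤ (k ℕ.* n ℕ.* (n ℕ.* n)) _ _ (begin
        n ℕ.* (k ℕ.* (n ℕ.* n)) ℕ.+ k ℕ.* n ℕ.* (n ℕ.* n)   ≡⟨ regroup k n ⟩
        2 ℕ.* k ℕ.* n ℕ.* (n ℕ.* n)                         ≤⟨ ℕ.*-monoʳ-≤ (2 ℕ.* k ℕ.* n) n*n≤∑rep ⟩
        2 ℕ.* k ℕ.* n ℕ.* ∑ P rep                           ≡⟨ ∑-*ˡ P (2 ℕ.* k ℕ.* n) rep ⟨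
        ∑[ z ∈ P ] (2 ℕ.* k ℕ.* n ℕ.* rep z)                ≤⟨ ∑-mono P (λ {z} _ → am-gm k n (rep z)) ⟩
        ∑[ z ∈ P ] (k ℕ.* k ℕ.* (rep z ℕ.* rep z) ℕ.+ n ℕ.* n)
                                                            ≡⟨ ∑-+ P _ _ ⟩
        ∑[ z ∈ P ] (k ℕ.* k ℕ.* (rep z ℕ.* rep z)) ℕ.+ ∑[ z ∈ P ] (n ℕ.* n)
                                                            ≡⟨ ≡.cong₂ ℕ._+_ (∑-*ˡ P (k ℕ.* k) _) (∑-const P (n ℕ.* n)) ⟩
        k ℕ.* k ℕ.* E ℕ.+ length P ℕ.* (n ℕ.* n)
          ≤⟨ ℕ.+-monoʳ-≤ (k ℕ.* k ℕ.* E) (ℕ.*-monoˡ-≤ (n ℕ.* n) A⊗A≤) ⟩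
        k ℕ.* k ℕ.* E ℕ.+ k ℕ.* n ℕ.* (n ℕ.* n)             ∎)
        where
        open ℕ.≤-Reasoning
        regroup : ∀ k n → n ℕ.* (k ℕ.* (n ℕ.* n)) ℕ.+ k ℕ.* n ℕ.* (n ℕ.* n) ≡ 2 ℕ.* k ℕ.* n ℕ.* (n ℕ.* n)
        regroup = solve-∀

    energy-at : Carrier → ℕ
    energy-at b = ∑[ z ∈ P ] (β b z ℕ.* rep z)

    E≡∑energy-at : k ℕ.* k ℕ.* E ≡ ∑[ b ∈ L ] (k ℕ.* k ℕ.* energy-at b)
    E≡∑energy-at = begin
      k ℕ.* k ℕ.* E
        ≡⟨ ≡.cong (k ℕ.* k ℕ.*_) (∑-cong P (λ z → ∑-*ʳ L (λ b → β b z) (rep z))) ⟩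
      k ℕ.* k ℕ.* (∑[ z ∈ P ] ∑[ b ∈ L ] (β b z ℕ.* rep z))
        ≡⟨ ≡.cong (k ℕ.* k ℕ.*_) (∑-swap P L (λ z b → β b z ℕ.* rep z)) ⟩
      k ℕ.* k ℕ.* ∑ L energy-at                               ≡⟨ ∑-*ˡ L (k ℕ.* k) energy-at ⟨
      ∑[ b ∈ L ] (k ℕ.* k ℕ.* energy-at b)                    ∎
      where
      open ≡.≡-Reasoning
      ∑-*ʳ : ∀ (xs : List Carrier) f m → ∑ xs f ℕ.* m ≡ ∑[ x ∈ xs ] (f x ℕ.* m)
      ∑-*ʳ xs f m = ≡.trans (ℕ.*-comm (∑ xs f) m)
        (≡.trans (≡.sym (∑-*ˡ xs m f)) (∑-cong xs (λ x → ℕ.*-comm m (f x))))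

    opaque
      -- Expanding one factor `rep z` distributes the energy, which is at least `n³ / k`, over the
      -- `n` elements `b`; one of them receives at least the average `n² / k`. The common factor
      -- `k * k` avoids division.
      rich : ∃[ b ] (b Propositional.∈ L × k ℕ.* (n ℕ.* n) ℕ.≤ k ℕ.* k ℕ.* energy-at b)
      rich = ∑-pigeonhole′ L (λ b → k ℕ.* k ℕ.* energy-at b) (k ℕ.* (n ℕ.* n))
               (ℕ.≤-trans energy (ℕ.≤-reflexive E≡∑energy-at)) A≢∅
        where
        ∑-pigeonhole′ : ∀ (xs : List Carrier) f n → length xs ℕ.* n ℕ.≤ ∑ xs f → 0 ℕ.< length xs →
                        ∃[ y ] (y Propositional.∈ xs × n ℕ.≤ f y)
        ∑-pigeonhole′ (x ∷ xs) f n le _ = ∑-pigeonhole x xs f n le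

    b : Carrier
    b = proj₁ rich

    b∈A : b ∈ A
    b∈A = ∈ₚL⇒∈A (proj₁ (proj₂ rich))

    Common? : ∀ a → Unary.Decidable (λ z → z ∈ b ·ˡ A × z ∈ a ·ˡ A)
    Common? a z = (z ∈? b ·ˡ A) ×-dec (z ∈? a ·ˡ A)

    I : Carrier → FinSubset
    I a = filter (Common? a) P

    I⁻ : ∀ a {z} → z ∈ I a → z ∈ b ·ˡ A × z ∈ a ·ˡ A
    I⁻ a z∈ = proj₂ (∈-filter⁻ (Common? a) (λ x≈y (x∈ , x∈′) → ∈-resp x≈y x∈ , ∈-resp x≈y x∈′) {P} z∈)

    I-length≤ : ∀ a → length (I a) ℕ.≤ ∣ I a ∣
    I-length≤ a = length≤card (Unique.filter⁺ setoid (Common? a) (deduplicate-unique (A ⊗ A)))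

    ∣I∣≤n : ∀ a → ∣ I a ∣ ℕ.≤ n
    ∣I∣≤n a = ℕ.≤-trans (card-mono {I a} {b ·ˡ A} (proj₁ ∘ I⁻ a)) (card-image (b *_) *-congˡ A)

    -- Exchanging the sums turns the share of `b` into the total size of the intersections of `b A`
    -- with the dilates `a A`.
    energy-at-b≤ : energy-at b ℕ.≤ ∑[ a ∈ L ] ∣ I a ∣
    energy-at-b≤ = begin
      ∑[ z ∈ P ] (β b z ℕ.* rep z)                  ≡⟨ ∑-cong P (λ z → ∑-*ˡ L (β b z) (λ a → β a z)) ⟨
      ∑[ z ∈ P ] ∑[ a ∈ L ] (β b z ℕ.* β a z)       ≡⟨ ∑-swap P L (λ z a → β b z ℕ.* β a z) ⟩
      ∑[ a ∈ L ] ∑[ z ∈ P ] (β b z ℕ.* β a z)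
        ≡⟨ ∑-cong L (λ a → ≡.trans
          (∑-cong P (indicator-× (_∈? b ·ˡ A) (_∈? a ·ˡ A)))
          (∑-indicator (Common? a) P)) ⟩
      ∑[ a ∈ L ] length (I a)                       ≤⟨ ∑-mono L (λ {a} _ → I-length≤ a) ⟩
      ∑[ a ∈ L ] ∣ I a ∣                            ∎
      where open ℕ.≤-Reasoning

    Popular? : Unary.Decidable (λ a → n ℕ.≤ 2 ℕ.* k ℕ.* ∣ I a ∣)
    Popular? a = n ℕ.≤? 2 ℕ.* k ℕ.* ∣ I a ∣

    A′ : FinSubset
    A′ = filter Popular? L

    A′⊆A : A′ ⊆ A
    A′⊆A a∈ with Propositional.find a∈
    ... | a′ , a′∈ , a≈a′ = ∈-resp (sym a≈a′) (∈ₚL⇒∈A (proj₁ (Propositional.∈-filter⁻ Popular? a′∈)))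

    popular : ∀ {a} → a ∈ A′ → ∃[ I ] (I ⊆ a ·ˡ A × I ⊆ b ·ˡ A × ∣ A ∣ ℕ.≤ 2 ℕ.* k ℕ.* ∣ I ∣)
    popular {a} a∈ with Propositional.find a∈
    ... | a′ , a′∈ , a≈a′ = I a′ , transport , proj₁ ∘ I⁻ a′ , proj₂ (Propositional.∈-filter⁻ Popular? {xs = L} a′∈)
      where
      transport : I a′ ⊆ a ·ˡ A
      transport z∈ with ∈-image⁻ (proj₂ (I⁻ a′ z∈))
      ... | x , x∈ , z≈ = ∈-resp (sym (trans z≈ (*-congʳ (sym a≈a′)))) (∈-image⁺ *-congˡ x∈)

    summand-bound : ∀ a → 2 ℕ.* k ℕ.* ∣ I a ∣ ℕ.≤ n ℕ.+ 2 ℕ.* k ℕ.* n ℕ.* indicator Popular? a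
    summand-bound a with Popular? a
    ... | yes _   = ℕ.≤-trans (ℕ.*-monoʳ-≤ (2 ℕ.* k) (∣I∣≤n a))
                      (ℕ.≤-trans (ℕ.≤-reflexive (≡.sym (ℕ.*-identityʳ (2 ℕ.* k ℕ.* n)))) (ℕ.m≤n+m _ n))
    ... | no  few = ℕ.≤-trans (ℕ.<⇒≤ (ℕ.≰⇒> few)) (ℕ.m≤m+n n _)

    energy-at-b-bound : 2 ℕ.* k ℕ.* energy-at b ℕ.≤ n ℕ.* n ℕ.+ 2 ℕ.* k ℕ.* n ℕ.* ∣ A′ ∣
    energy-at-b-bound = begin
      2 ℕ.* k ℕ.* energy-at b                                  ≤⟨ ℕ.*-monoʳ-≤ (2 ℕ.* k) energy-at-b≤ ⟩
      2 ℕ.* k ℕ.* ∑[ a ∈ L ] ∣ I a ∣                           ≡⟨ ∑-*ˡ L (2 ℕ.* k) (λ a → ∣ I a ∣) ⟨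
      ∑[ a ∈ L ] (2 ℕ.* k ℕ.* ∣ I a ∣)                         ≤⟨ ∑-mono L (λ {a} _ → summand-bound a) ⟩
      ∑[ a ∈ L ] (n ℕ.+ 2 ℕ.* k ℕ.* n ℕ.* indicator Popular? a)
                                                               ≡⟨ ∑-+ L _ _ ⟩
      ∑[ a ∈ L ] n ℕ.+ ∑[ a ∈ L ] (2 ℕ.* k ℕ.* n ℕ.* indicator Popular? a)
                                                               ≡⟨ ≡.cong₂ ℕ._+_ (∑-const L n) (∑-*ˡ L (2 ℕ.* k ℕ.* n) (indicator Popular?)) ⟩
      n ℕ.* n ℕ.+ 2 ℕ.* k ℕ.* n ℕ.* ∑ L (indicator Popular?)
        ≡⟨ ≡.cong (λ m → n ℕ.* n ℕ.+ 2 ℕ.* k ℕ.* n ℕ.* m) (∑-indicator Popular? L) ⟩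
      n ℕ.* n ℕ.+ 2 ℕ.* k ℕ.* n ℕ.* length A′
        ≤⟨ ℕ.+-monoʳ-≤ (n ℕ.* n) (ℕ.*-monoʳ-≤ (2 ℕ.* k ℕ.* n)
          (length≤card (Unique.filter⁺ setoid Popular? (deduplicate-unique A)))) ⟩
      n ℕ.* n ℕ.+ 2 ℕ.* k ℕ.* n ℕ.* ∣ A′ ∣                     ∎
      where open ℕ.≤-Reasoning

    k>0 : 0 ℕ.< k
    k>0 with card>0⇒∈ {A} A≢∅
    ... | a , a∈ = ℕ.n≢0⇒n>0 λ k≡0 → ℕ.<⇒≱ (∈⇒card>0 {A ⊗ A} (∈-⊗⁺ a∈ a∈)) (≡.subst (λ k → ∣ A ⊗ A ∣ ℕ.≤ k ℕ.* n) k≡0 A⊗A≤)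

    -- The intersections have total size at least `n² / k`. Unpopular `a` contribute at most
    -- `n / 2k` each, hence at most half of that; popular ones contribute at most `n` each, so about
    -- `n / 2k` of them are required.
    n≤2k∣A′∣ : n ℕ.≤ 2 ℕ.* k ℕ.* ∣ A′ ∣
    n≤2k∣A′∣ = ℕ.*-cancelˡ-≤ (k ℕ.* n) {{ℕ.m*n≢0 k n {{ℕ.>-nonZero k>0}} {{ℕ.>-nonZero A≢∅}}}}
      (ℕ.+-cancelˡ-≤ (k ℕ.* n ℕ.* n) _ _ (begin
        k ℕ.* n ℕ.* n ℕ.+ k ℕ.* n ℕ.* n                       ≡⟨ double k n ⟩
        2 ℕ.* (k ℕ.* (n ℕ.* n))                               ≤⟨ ℕ.*-monoʳ-≤ 2 (proj₂ (proj₂ rich)) ⟩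
        2 ℕ.* (k ℕ.* k ℕ.* energy-at b)                       ≡⟨ regroup k (energy-at b) ⟩
        k ℕ.* (2 ℕ.* k ℕ.* energy-at b)                       ≤⟨ ℕ.*-monoʳ-≤ k energy-at-b-bound ⟩
        k ℕ.* (n ℕ.* n ℕ.+ 2 ℕ.* k ℕ.* n ℕ.* ∣ A′ ∣)          ≡⟨ expand k n ∣ A′ ∣ ⟩
        k ℕ.* n ℕ.* n ℕ.+ k ℕ.* n ℕ.* (2 ℕ.* k ℕ.* ∣ A′ ∣)    ∎))
      where
      open ℕ.≤-Reasoning
      double : ∀ k n → k ℕ.* n ℕ.* n ℕ.+ k ℕ.* n ℕ.* n ≡ 2 ℕ.* (k ℕ.* (n ℕ.* n))
      double = solve-∀
      regroup : ∀ k e → 2 ℕ.* (k ℕ.* k ℕ.* e) ≡ k ℕ.* (2 ℕ.* k ℕ.* e)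
      regroup = solve-∀
      expand : ∀ k n m → k ℕ.* (n ℕ.* n ℕ.+ 2 ℕ.* k ℕ.* n ℕ.* m) ≡ k ℕ.* n ℕ.* n ℕ.+ k ℕ.* n ℕ.* (2 ℕ.* k ℕ.* m)
      expand = solve-∀

    opaque
      popular-dilates : ∃[ b ] ∃[ A′ ] (b ∈ A × A′ ⊆ A × ∣ A ∣ ℕ.≤ 2 ℕ.* k ℕ.* ∣ A′ ∣ ×
                          (∀ {a} → a ∈ A′ → ∃[ I ] (I ⊆ a ·ˡ A × I ⊆ b ·ˡ A × ∣ A ∣ ℕ.≤ 2 ℕ.* k ℕ.* ∣ I ∣)))
      popular-dilates = b , A′ , b∈A , (λ {x} → A′⊆A {x}) , n≤2k∣A′∣ , λ {a} → popular {a}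

-- Inverses and quotient sets in a division ring

module DivisionRing {c ℓ} (D : Ring c ℓ) (division : IsDivisionRing D)
                    (_≟_ : Decidable (Ring._≈_ D)) where
  open Ring D
  open FiniteSubsets D _≟_
  open SumSets D _≟_
  open Algebra.Properties.Ring D using (-0#≈0#; x[y-z]≈xy-xz)
  open Algebra.Properties.AbelianGroup +-abelianGroup using (x∙y⁻¹≈ε⇒x≈y)

  -- inv 0# is 0#, so Quotient below need not exclude zero denominators: they
  -- only contribute 0#.
  inv : Carrier → Carrier
  inv x with x ≟ 0#
  ... | yes _   = 0#
  ... | no  x≉0 = proj₁ (division x x≉0)

  inv-zero : ∀ {x} → x ≈ 0# → inv x ≈ 0#
  inv-zero {x} x≈0 with x ≟ 0#
  ... | yes _   = refl
  ... | no  x≉0 = ⊥-elim (x≉0 x≈0)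

  inv-inverseˡ : ∀ {x} → ¬ (x ≈ 0#) → inv x * x ≈ 1#
  inv-inverseˡ {x} x≉0 with x ≟ 0#
  ... | yes x≈0  = ⊥-elim (x≉0 x≈0)
  ... | no  x≉0′ = proj₁ (proj₂ (division x x≉0′))

  inv-inverseʳ : ∀ {x} → ¬ (x ≈ 0#) → x * inv x ≈ 1#
  inv-inverseʳ {x} x≉0 with x ≟ 0#
  ... | yes x≈0  = ⊥-elim (x≉0 x≈0)
  ... | no  x≉0′ = proj₂ (proj₂ (division x x≉0′))

  cancelˡ-inverse : ∀ {g h} → g * h ≈ 1# → ∀ x → g * (h * x) ≈ x
  cancelˡ-inverse {g} {h} gh≈1 x = trans (sym (*-assoc g h x)) (trans (*-congʳ gh≈1) (*-identityˡ x))

  cancelʳ-inverse : ∀ {g h} → g * h ≈ 1# → ∀ x → (x * g) * h ≈ x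
  cancelʳ-inverse {g} {h} gh≈1 x = trans (*-assoc x g h) (trans (*-congˡ gh≈1) (*-identityʳ x))

  inv-unique : ∀ {x y} → ¬ (x ≈ 0#) → x * y ≈ 1# → inv x ≈ y
  inv-unique {x} {y} x≉0 xy≈1 = begin
    inv x            ≈⟨ *-identityʳ _ ⟨
    inv x * 1#       ≈⟨ *-congˡ xy≈1 ⟨
    inv x * (x * y)  ≈⟨ cancelˡ-inverse (inv-inverseˡ x≉0) y ⟩
    y                ∎
    where open ≈-Reasoning

  inv-cong : inv Preserves _≈_ ⟶ _≈_
  inv-cong {x} {y} x≈y = by-cases (x ≟ 0#)
    where
    by-cases : Dec (x ≈ 0#) → inv x ≈ inv y
    by-cases (yes x≈0) = trans (inv-zero x≈0) (sym (inv-zero (trans (sym x≈y) x≈0)))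
    by-cases (no  x≉0) = inv-unique x≉0 (trans (*-congʳ x≈y) (inv-inverseʳ (λ y≈0 → x≉0 (trans x≈y y≈0))))

  -- Holds for `x ≈ 0#` as well, both sides being zero by the convention for `inv`; conjugation of
  -- quotient sets therefore needs no case distinction.
  inv-*ˡ : ∀ {g h} → g * h ≈ 1# → h * g ≈ 1# → ∀ x → inv (g * x) ≈ inv x * h
  inv-*ˡ {g} {h} gh≈1 hg≈1 x = by-cases (x ≟ 0#)
    where
    by-cases : Dec (x ≈ 0#) → inv (g * x) ≈ inv x * h
    by-cases (yes x≈0) = trans (inv-zero (trans (*-congˡ x≈0) (zeroʳ g)))
      (sym (trans (*-congʳ (inv-zero x≈0)) (zeroˡ h)))
    by-cases (no  x≉0) = inv-unique
      (λ gx≈0 → x≉0 (trans (sym (cancelˡ-inverse hg≈1 x)) (trans (*-congˡ gx≈0) (zeroʳ h))))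
      (begin
        (g * x) * (inv x * h)    ≈⟨ *-assoc (g * x) (inv x) h ⟨
        ((g * x) * inv x) * h    ≈⟨ *-congʳ (cancelʳ-inverse (inv-inverseʳ x≉0) g) ⟩
        g * h                    ≈⟨ gh≈1 ⟩
        1#                       ∎)
      where open ≈-Reasoning

  -- The inverse stands on the right, so that an equation `x (v - v′) = u - u′` with distinct `v`,
  -- `v′` makes `x` a quotient. Such equations arise from coincidences in left dilates.
  Quotient : FinSubset → FinSubset
  Quotient U = (U ⊖ U) ⊗ map inv (U ⊖ U)

  Quotient⁺ : ∀ {U x u u′ v v′} → u ∈ U → u′ ∈ U → v ∈ U → v′ ∈ U →
              ¬ (v ≈ v′) → x * (v - v′) ≈ u - u′ → x ∈ Quotient U
  Quotient⁺ {U} {x} {u} {u′} {v} {v′} u∈ u′∈ v∈ v′∈ v≉v′ eq =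
    ∈-resp solve (∈-⊗⁺ (∈-⊖⁺ u∈ u′∈) (∈-image⁺ inv-cong (∈-⊖⁺ v∈ v′∈)))
    where
    v-v′≉0 : ¬ (v - v′ ≈ 0#)
    v-v′≉0 v-v′≈0 = v≉v′ (x∙y⁻¹≈ε⇒x≈y v v′ v-v′≈0)

    solve : (u - u′) * inv (v - v′) ≈ x
    solve = trans (*-congʳ (sym eq)) (cancelʳ-inverse (inv-inverseʳ v-v′≉0) x)

  -- A common left factor does not cancel but conjugates: `(g s) (g e)⁻¹ = g (s e⁻¹) g⁻¹`.
  Quotient-conjugate : ∀ {U V g h} → g * h ≈ 1# → h * g ≈ 1# → (∀ {u} → u ∈ U → g * u ∈ V) →
                       ∀ {x} → x ∈ Quotient U → (g * x) * h ∈ Quotient V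
  Quotient-conjugate {U} {V} {g} {h} gh≈1 hg≈1 gU⊆V {x} x∈ with ∈-image₂⁻ _*_ (U ⊖ U) (map inv (U ⊖ U)) x∈
  ... | s , t , s∈ , t∈ , x≈ with ∈-image⁻ t∈
  ...   | e , e∈ , t≈ = ∈-resp (sym eq) (∈-⊗⁺ (dilate s∈) (∈-image⁺ inv-cong (dilate e∈)))
    where
    dilate : ∀ {s} → s ∈ U ⊖ U → g * s ∈ V ⊖ V
    dilate s∈ with ∈-image₂⁻ _-_ U U s∈
    ... | u , u′ , u∈ , u′∈ , s≈ = ∈-resp (sym (trans (*-congˡ s≈) (x[y-z]≈xy-xz g u u′))) (∈-⊖⁺ (gU⊆V u∈) (gU⊆V u′∈))

    eq : (g * x) * h ≈ (g * s) * inv (g * e)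
    eq = begin
      (g * x) * h            ≈⟨ *-congʳ (*-congˡ (trans x≈ (*-congˡ t≈))) ⟩
      (g * (s * inv e)) * h  ≈⟨ *-congʳ (*-assoc g s (inv e)) ⟨
      ((g * s) * inv e) * h  ≈⟨ *-assoc (g * s) (inv e) h ⟩
      (g * s) * (inv e * h)  ≈⟨ *-congˡ (inv-*ˡ gh≈1 hg≈1 e) ⟨
      (g * s) * inv (g * e)  ∎
      where open ≈-Reasoning

  -- The subring of quotients of a large set

  module LargeSets (A : FinSubset) (k : ℕ) (A≢∅ : 0 ℕ.< ∣ A ∣)
                   (doubling : ∣ A ⊕ A ∣ ℕ.≤ k ℕ.* ∣ A ∣) (A-large : threshold k ℕ.< ∣ A ∣)
                   (b : Carrier) (b≉0 : ¬ (b ≈ 0#)) (A′ : FinSubset) (A′⊆A : A′ ⊆ A)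
                   (A′-large : ∣ A ∣ ℕ.≤ 2 ℕ.* k ℕ.* ∣ A′ ∣)
                   (popular : ∀ {a} → a ∈ A′ →
                              ∃[ I ] (I ⊆ a ·ˡ A × I ⊆ b ·ˡ A × ∣ A ∣ ℕ.≤ 2 ℕ.* k ℕ.* ∣ I ∣)) where
    open Plünnecke A k A≢∅ doubling using (2A-2A≤)
    open Goodness A k A≢∅ doubling

    n : ℕ
    n = ∣ A ∣

    B : FinSubset
    B = inv b ·ˡ A′

    bb⁻¹≈1 : b * inv b ≈ 1#
    bb⁻¹≈1 = inv-inverseʳ b≉0

    b⁻¹b≈1 : inv b * b ≈ 1#
    b⁻¹b≈1 = inv-inverseˡ b≉0

    ·ˡ-doubling : ∀ a → ∣ a ·ˡ A ⊕ a ·ˡ A ∣ ℕ.≤ k ℕ.* n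
    ·ˡ-doubling a = ℕ.≤-trans (card-mono {a ·ˡ A ⊕ a ·ˡ A} {a ·ˡ (A ⊕ A)} factor)
      (ℕ.≤-trans (card-image (a *_) *-congˡ (A ⊕ A)) doubling)
      where
      factor : a ·ˡ A ⊕ a ·ˡ A ⊆ a ·ˡ (A ⊕ A)
      factor z∈ with ∈-image₂⁻ _+_ (a ·ˡ A) (a ·ˡ A) z∈
      ... | s , t , s∈ , t∈ , z≈ with ∈-image⁻ s∈ | ∈-image⁻ t∈
      ...   | u , u∈ , s≈ | v , v∈ , t≈ =
        ∈-resp (trans (distribˡ a u v) (sym (trans z≈ (+-cong s≈ t≈)))) (∈-image⁺ *-congˡ (∈-⊕⁺ u∈ v∈))

    -- The triangle inequality through `I`: lying in both dilates, `I` keeps the two sums inside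
    -- `a (A + A)` and `b (A + A)`, while its size, at least `n / 2k`, costs only a factor `2k`.
    popular-difference : ∀ {a} → a ∈ A′ → ∣ (a ·ˡ A) ⊖ (b ·ˡ A) ∣ ℕ.≤ ε₀ k ℕ.* n
    popular-difference {a} a∈ = bound (popular a∈)
      where
      bound : ∃[ I ] (I ⊆ a ·ˡ A × I ⊆ b ·ˡ A × n ℕ.≤ 2 ℕ.* k ℕ.* ∣ I ∣) → ∣ (a ·ˡ A) ⊖ (b ·ˡ A) ∣ ℕ.≤ ε₀ k ℕ.* n
      bound (I , I⊆aA , I⊆bA , I-large) = ℕ.*-cancelˡ-≤ n {{ℕ.>-nonZero A≢∅}} (begin
        n ℕ.* d                                            ≤⟨ ℕ.*-monoˡ-≤ d I-large ⟩
        2 ℕ.* k ℕ.* ∣ I ∣ ℕ.* d                            ≡⟨ ℕ.*-assoc (2 ℕ.* k) ∣ I ∣ d ⟩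
        2 ℕ.* k ℕ.* (∣ I ∣ ℕ.* d)
          ≤⟨ ℕ.*-monoʳ-≤ (2 ℕ.* k) (ruzsa-triangle (a ·ˡ A) (b ·ˡ A) I) ⟩
        2 ℕ.* k ℕ.* (∣ a ·ˡ A ⊕ I ∣ ℕ.* ∣ b ·ˡ A ⊕ I ∣)
          ≤⟨ ℕ.*-monoʳ-≤ (2 ℕ.* k) (ℕ.*-mono-≤
            (ℕ.≤-trans (card-mono {a ·ˡ A ⊕ I} {a ·ˡ A ⊕ a ·ˡ A} (⊕-mono {a ·ˡ A} id I⊆aA)) (·ˡ-doubling a))
            (ℕ.≤-trans (card-mono {b ·ˡ A ⊕ I} {b ·ˡ A ⊕ b ·ˡ A} (⊕-mono {b ·ˡ A} id I⊆bA)) (·ˡ-doubling b))) ⟩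
        2 ℕ.* k ℕ.* (k ℕ.* n ℕ.* (k ℕ.* n))                ≡⟨ regroup k n ⟩
        n ℕ.* (ε₀ k ℕ.* n)                                 ∎)
        where
        open ℕ.≤-Reasoning
        d : ℕ
        d = ∣ (a ·ˡ A) ⊖ (b ·ˡ A) ∣
        regroup : ∀ k n → 2 ℕ.* k ℕ.* (k ℕ.* n ℕ.* (k ℕ.* n)) ≡ n ℕ.* (2 ℕ.* k ℕ.* (k ℕ.* k) ℕ.* n)
        regroup = solve-∀

    opaque
      good-B : ∀ {x} → x ∈ B → Good (ε₀ k) x
      good-B {x} x∈ =
        let a , a∈ , x≈ = ∈-image⁻ x∈
        in good-ratio (ε₀ k) b⁻¹b≈1 (trans (*-congˡ x≈) (cancelˡ-inverse bb⁻¹≈1 a)) (popular-difference a∈)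

    opaque
      good-B-B : ∀ {x} → x ∈ B ⊖ B → Good (ε₁ k) x
      good-B-B x∈ =
        let u , v , u∈ , v∈ , x≈ = ∈-image₂⁻ _-_ B B x∈
        in good-resp (sym x≈) (good-+ (good-B u∈) (good-neg (good-B v∈)))

    opaque
      good-inv : ∀ {x} → x ∈ B ⊖ B → Good (ε₁′ k) (inv x)
      good-inv {x} x∈ = by-cases (x ≟ 0#)
        where
        by-cases : Dec (x ≈ 0#) → Good (ε₁′ k) (inv x)
        -- The zero denominator has `inv` equal to zero and needs one translate: the summand `1` of
        -- `ε₁′ k`.
        by-cases (yes x≈0) = good-mono (ℕ.m≤m+n 1 _) (good-resp (sym (inv-zero x≈0)) good-0#)
        by-cases (no  x≉0) = good-mono (ℕ.m≤n+m (κ k ℕ.* ε₁ k) 1)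
          (good-inverse (good-B-B x∈) (inv-inverseˡ x≉0) (inv-inverseʳ x≉0))

    S : FinSubset
    S = Quotient B

    opaque
      good-S : ∀ {x} → x ∈ S → Good (ε₂ k) x
      good-S x∈ =
        let s , t , s∈ , t∈ , x≈ = ∈-image₂⁻ _*_ (B ⊖ B) (map inv (B ⊖ B)) x∈
            e , e∈ , t≈ = ∈-image⁻ t∈
        in good-resp (sym (trans x≈ (*-congˡ t≈))) (good-* (good-B-B s∈) (good-inv e∈))

    opaque
      good⇒∈Quotient : ∀ {x} → Good (ε₃ k) x → x ∈ Quotient A′
      good⇒∈Quotient {x} gx = by-cases (x ∈? Quotient A′)
        where
        too-small : ∣ A′ ∣ ℕ.* ∣ A′ ∣ ℕ.≤ ∣ A ⊕ x ·ˡ A ∣ → n ℕ.≤ threshold k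
        -- The second summand of `threshold k` comes from here: `(n / 2k)² ≤ ∣ A′ ∣² ≤ ∣ A + x A ∣ ≤
        -- κ k * n * ε₃ k`, and one factor `n` cancels.
        too-small le = ℕ.≤-trans (ℕ.*-cancelʳ-≤ _ _ n {{ℕ.>-nonZero A≢∅}} bound) (ℕ.m≤n+m _ (ε₂ k))
          where
          open ℕ.≤-Reasoning
          rearrange : ∀ k a → 2 ℕ.* k ℕ.* a ℕ.* (2 ℕ.* k ℕ.* a) ≡ 2 ℕ.* k ℕ.* (2 ℕ.* k) ℕ.* (a ℕ.* a)
          rearrange = solve-∀
          rearrange′ : ∀ c q n e → c ℕ.* (q ℕ.* n ℕ.* e) ≡ c ℕ.* (q ℕ.* e) ℕ.* n
          rearrange′ = solve-∀
          bound : n ℕ.* n ℕ.≤ 2 ℕ.* k ℕ.* (2 ℕ.* k) ℕ.* (κ k ℕ.* ε₃ k) ℕ.* n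
          bound = begin
            n ℕ.* n                                                      ≤⟨ ℕ.*-mono-≤ A′-large A′-large ⟩
            2 ℕ.* k ℕ.* ∣ A′ ∣ ℕ.* (2 ℕ.* k ℕ.* ∣ A′ ∣)                  ≡⟨ rearrange k ∣ A′ ∣ ⟩
            2 ℕ.* k ℕ.* (2 ℕ.* k) ℕ.* (∣ A′ ∣ ℕ.* ∣ A′ ∣)
              ≤⟨ ℕ.*-monoʳ-≤ (2 ℕ.* k ℕ.* (2 ℕ.* k)) (ℕ.≤-trans le (card-⊕-covered gx)) ⟩
            2 ℕ.* k ℕ.* (2 ℕ.* k) ℕ.* (κ k ℕ.* n ℕ.* ε₃ k)
              ≡⟨ rearrange′ (2 ℕ.* k ℕ.* (2 ℕ.* k)) (κ k) n (ε₃ k) ⟩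
            2 ℕ.* k ℕ.* (2 ℕ.* k) ℕ.* (κ k ℕ.* ε₃ k) ℕ.* n               ∎

        by-cases : Dec (x ∈ Quotient A′) → x ∈ Quotient A′
        by-cases (yes x∈) = x∈
        by-cases (no  x∉) = ⊥-elim (ℕ.<⇒≱ A-large (too-small
          (card-injection₂ {A′} {A′} {A ⊕ x ·ˡ A} (λ u v → u + x * v)
            (λ u∈ v∈ → ∈-⊕⁺ (A′⊆A u∈) (∈-image⁺ *-congˡ (A′⊆A v∈))) injective)))
          where
          injective : ∀ {u v u′ v′} → u ∈ A′ → v ∈ A′ → u′ ∈ A′ → v′ ∈ A′ →
                      u + x * v ≈ u′ + x * v′ → u ≈ u′ × v ≈ v′
          injective {u} {v} {u′} {v′} u∈ v∈ u′∈ v′∈ eq = by-cases′ (v ≟ v′)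
            where
            by-cases′ : Dec (v ≈ v′) → u ≈ u′ × v ≈ v′
            by-cases′ (yes v≈v′) = +-cancelʳ (x * v) (trans eq (+-congˡ (*-congˡ (sym v≈v′)))) , v≈v′
            -- A collision with `v` and `v′` distinct reads `x (v - v′) = u′ - u` and exhibits `x`
            -- as a quotient.
            by-cases′ (no  v≉v′) = ⊥-elim (x∉ (Quotient⁺ u′∈ u∈ v∈ v′∈ v≉v′
              (trans (x[y-z]≈xy-xz x v v′)
                (x+y≈z+w⇒x-z≈w-y (trans (+-comm (x * v) u) (trans eq (+-comm u′ (x * v′))))))))

    S⊆QA′ : S ⊆ Quotient A′
    S⊆QA′ x∈ = good⇒∈Quotient (good-mono (ℕ.≤-trans (ℕ.m≤m+n (ε₂ k) _) (ℕ.m≤n+m _ (1 ℕ.+ ε₀ k))) (good-S x∈))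

    conjugate : ∀ {x} → x ∈ Quotient A′ → (inv b * x) * b ∈ S
    conjugate = Quotient-conjugate {A′} {B} b⁻¹b≈1 bb⁻¹≈1 (∈-image⁺ *-congˡ)

    conjugate⁻¹ : ∀ {x} → x ∈ S → (b * x) * inv b ∈ Quotient A′
    conjugate⁻¹ = Quotient-conjugate {B} {A′} bb⁻¹≈1 b⁻¹b≈1 λ u∈ →
      let a , a∈ , u≈ = ∈-image⁻ u∈
      in ∈-resp (sym (trans (*-congˡ u≈) (cancelˡ-inverse bb⁻¹≈1 a))) a∈

    opaque
      QA′⊆S : Quotient A′ ⊆ S
      QA′⊆S = card-≥⇒⊇ {S} {Quotient A′} S⊆QA′
        (card-injection {Quotient A′} {S} (λ x → (inv b * x) * b) conjugate injective)
        where
        open ≈-Reasoning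
        injective : ∀ {x y} → (inv b * x) * b ≈ (inv b * y) * b → x ≈ y
        injective {x} {y} eq = *-leftInjective bb⁻¹≈1 (begin
          inv b * x                  ≈⟨ cancelʳ-inverse bb⁻¹≈1 (inv b * x) ⟨
          ((inv b * x) * b) * inv b  ≈⟨ *-congʳ eq ⟩
          ((inv b * y) * b) * inv b  ≈⟨ cancelʳ-inverse bb⁻¹≈1 (inv b * y) ⟩
          inv b * y                  ∎)

    -- `ε₃ k` is the sum of the bounds for everything that has to land in `S`: zero, the elements of
    -- `B`, quotients and their negatives, sums and products. Each application selects one summand.
    good⇒∈S : ∀ {M x} → M ℕ.≤ ε₃ k → Good M x → x ∈ S
    good⇒∈S M≤ gx = QA′⊆S (good⇒∈Quotient (good-mono M≤ gx))

    opaque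
      S-subring : IsSubring S
      S-subring = record
        { 0#-mem   = good⇒∈S (ℕ.≤-trans (ℕ.m≤m+n 1 _) (ℕ.m≤m+n (1 ℕ.+ ε₀ k) _)) good-0#
        ; +-closed = λ x∈ y∈ → good⇒∈S
            (ℕ.≤-trans (ℕ.m≤m+n _ _) (ℕ.≤-trans (ℕ.m≤n+m _ (ε₂ k)) (ℕ.m≤n+m _ (1 ℕ.+ ε₀ k))))
            (good-+ (good-S x∈) (good-S y∈))
        ; -‿closed = λ x∈ → good⇒∈S (ℕ.≤-trans (ℕ.m≤m+n (ε₂ k) _) (ℕ.m≤n+m _ (1 ℕ.+ ε₀ k)))
            (good-neg (good-S x∈))
        ; *-closed = λ x∈ y∈ → good⇒∈S
            (ℕ.≤-trans (ℕ.m≤n+m _ (ρ k ℕ.* (ε₂ k ℕ.* ε₂ k))) (ℕ.≤-trans (ℕ.m≤n+m _ (ε₂ k)) (ℕ.m≤n+m _ (1 ℕ.+ ε₀ k))))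
            (good-* (good-S x∈) (good-S y∈))
        }

    -- `S` is built from differences, which does not by itself exhibit the elements of `B`; they
    -- enter because they are good.
    B⊆S : B ⊆ S
    B⊆S x∈ = good⇒∈S (ℕ.≤-trans (ℕ.m≤n+m (ε₀ k) 1) (ℕ.m≤m+n (1 ℕ.+ ε₀ k) _)) (good-B x∈)

    A′-A′⊆bS : A′ ⊖ A′ ⊆ b ·ˡ S
    A′-A′⊆bS z∈ with ∈-image₂⁻ _-_ A′ A′ z∈
    ... | u , v , u∈ , v∈ , z≈ = ∈-resp (sym (trans z≈ eq)) (∈-image⁺ *-congˡ
            (IsSubring.+-closed S-subring (B⊆S (∈-image⁺ *-congˡ u∈))
              (IsSubring.-‿closed S-subring (B⊆S (∈-image⁺ *-congˡ v∈)))))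
      where
      eq : u - v ≈ b * (inv b * u - inv b * v)
      eq = sym (trans (x[y-z]≈xy-xz b _ _) (minus-cong (cancelˡ-inverse bb⁻¹≈1 u) (cancelˡ-inverse bb⁻¹≈1 v)))

    -- `b s = (b s b⁻¹) b` and `s b = b (b⁻¹ s b)`, and conjugation by `b` in either direction
    -- exchanges `S` and `Quotient A′`, which are the same set.
    bS≐Sb : b ·ˡ S ≐ S ·ʳ b
    bS≐Sb = bS⊆Sb , Sb⊆bS
      where
      bS⊆Sb : b ·ˡ S ⊆ S ·ʳ b
      bS⊆Sb z∈ with ∈-image⁻ z∈
      ... | s , s∈ , z≈ = ∈-resp (trans (cancelʳ-inverse b⁻¹b≈1 (b * s)) (sym z≈))
              (∈-image⁺ *-congʳ (QA′⊆S (conjugate⁻¹ s∈)))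

      Sb⊆bS : S ·ʳ b ⊆ b ·ˡ S
      Sb⊆bS z∈ with ∈-image⁻ z∈
      ... | s , s∈ , z≈ = ∈-resp (trans (*-congˡ (*-assoc (inv b) s b)) (trans (cancelˡ-inverse bb⁻¹≈1 (s * b)) (sym z≈)))
              (∈-image⁺ *-congˡ (conjugate (S⊆QA′ s∈)))

    -- More elements v of A than translates needed to cover s * A: two of the
    -- s * v lie in the same translate of H, so s (v - v′) ∈ H - H.
    opaque
      card-S : ∣ S ∣ ℕ.≤ κ k ℕ.* n ℕ.* (suc (ε₂ k) ℕ.* suc (ε₂ k))
      card-S = ℕ.≤-trans (card-mono {S} {R} S⊆R) (ℕ.≤-trans (card-image₂ _*_ *-cong (H ⊖ H) (map inv (V ⊖ V)))
        (ℕ.*-mono-≤ H-H≤ V-V≤))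
        where
        -- Denominators from all of `A` would make the bound superlinear in `n`; drawing them from
        -- boundedly many elements keeps it linear. The first summand of `threshold k` ensures that
        -- `A` has `suc (ε₂ k)` elements.
        V : FinSubset
        V = take (suc (ε₂ k)) (deduplicate _≟_ A)

        V-length : length V ≡ suc (ε₂ k)
        V-length = ≡.trans (length-take (suc (ε₂ k)) (deduplicate _≟_ A))
          (ℕ.m≤n⇒m⊓n≡m (ℕ.≤-trans (ℕ.s≤s (ℕ.m≤m+n (ε₂ k) _)) A-large))

        V! : Unique setoid V
        V! = Unique.take⁺ setoid (suc (ε₂ k)) (deduplicate-unique A)

        V⊆A : ∀ {v} → v Propositional.∈ V → v ∈ A
        V⊆A v∈ = ∈-deduplicate⁻ (Any.map reflexive (take-⊆ (suc (ε₂ k)) (deduplicate _≟_ A) v∈))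
          where
          take-⊆ : ∀ m (xs : List Carrier) {x} → x Propositional.∈ take m xs → x Propositional.∈ xs
          take-⊆ (suc m) (x ∷ xs) (here eq)  = here eq
          take-⊆ (suc m) (x ∷ xs) (there x∈) = there (take-⊆ m xs x∈)

        R : FinSubset
        R = (H ⊖ H) ⊗ map inv (V ⊖ V)

        H-H≤ : ∣ H ⊖ H ∣ ℕ.≤ κ k ℕ.* n
        H-H≤ = ℕ.≤-trans (card-mono {H ⊖ H} {(A ⊕ A) ⊖ (A ⊕ A)} H-H⊆) 2A-2A≤
          where
          H-H⊆ : H ⊖ H ⊆ (A ⊕ A) ⊖ (A ⊕ A)
          H-H⊆ z∈ with ∈-image₂⁻ _-_ H H z∈
          ... | x , y , x∈ , y∈ , z≈ = ∈-resp (sym z≈) (H-H⊆2A-2A x∈ y∈)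

        V-V≤ : ∣ map inv (V ⊖ V) ∣ ℕ.≤ suc (ε₂ k) ℕ.* suc (ε₂ k)
        V-V≤ = ℕ.≤-trans (card≤length (map inv (V ⊖ V))) (ℕ.≤-reflexive
          (≡.trans (length-map inv (V ⊖ V)) (≡.trans (length-cartesianProductWith _-_ V V)
            (≡.cong₂ ℕ._*_ V-length V-length))))

        S⊆R : S ⊆ R
        S⊆R {s} s∈ = by-cases (s ∈? R) (good-S s∈)
          where
          by-cases : Dec (s ∈ R) → Good (ε₂ k) s → s ∈ R
          by-cases (yes s∈R) _ = s∈R
          by-cases (no  s∉R) (T , T≤ , sA⊆) = ⊥-elim (ℕ.1+n≰n (ℕ.≤-trans
              (ℕ.≤-reflexive (≡.sym V-length))
              (ℕ.≤-trans (length-mono-injective SameTranslate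
                (AllPairs-map∈ distinct V!)
                (All.tabulate λ v∈ → translate (∈-image₂⁻ _+_ H T (sA⊆ (∈-image⁺ *-congˡ (V⊆A v∈))))))
              T≤)))
            where
            SameTranslate : Carrier → Carrier → Set (c ⊔ ℓ)
            SameTranslate v t = ∃[ h ] (h ∈ H × s * v ≈ h + t)

            translate : ∀ {z} → ∃[ h ] ∃[ t ] (h ∈ H × t ∈ T × z ≈ h + t) → Any (λ t → ∃[ h ] (h ∈ H × z ≈ h + t)) T
            translate (h , t , h∈ , t∈ , z≈) = Any.map (λ t≈ → h , h∈ , trans z≈ (+-congˡ t≈)) t∈

            distinct : ∀ {v v′} → v Propositional.∈ V → v′ Propositional.∈ V → ¬ (v ≈ v′) → NoCommonImage SameTranslate v v′
            distinct {v} {v′} v∈ v′∈ v≉v′ {t} (h , h∈ , sv≈) (h′ , h′∈ , sv′≈) = s∉R (∈-resp solve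
                (∈-⊗⁺ (∈-⊖⁺ h∈ h′∈) (∈-image⁺ inv-cong (∈-⊖⁺ (Any.map reflexive v∈) (Any.map reflexive v′∈)))))
              where
              s[v-v′]≈h-h′ : s * (v - v′) ≈ h - h′
              s[v-v′]≈h-h′ = trans (x[y-z]≈xy-xz s v v′) (trans (minus-cong sv≈ sv′≈) (x+z-[y+z]≈x-y h h′ t))

              solve : (h - h′) * inv (v - v′) ≈ s
              solve = trans (*-congʳ (sym s[v-v′]≈h-h′))
                (cancelʳ-inverse (inv-inverseʳ (λ v-v′≈0 → v≉v′ (x∙y⁻¹≈ε⇒x≈y v v′ v-v′≈0))) s)

  -- Small sets, removal of zero, and the theorem for integer constants

  nonzero-element : ∀ U → NonEmpty U → ¬ (U ≐ [ 0# ]) → ∃[ a ] (a ∈ U × ¬ (a ≈ 0#))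
  nonzero-element []         U≢∅ _   = ⊥-elim (U≢∅ ≡.refl)
  nonzero-element U@(x ∷ xs) _   U≢0 = by-cases (Any.any? (λ u → ¬? (u ≟ 0#)) U)
    where
    by-cases : Dec (Any (λ u → ¬ (u ≈ 0#)) U) → ∃[ a ] (a ∈ U × ¬ (a ≈ 0#))
    by-cases (yes some) = let a , a∈ , a≉0 = Propositional.find some in a , Any.map reflexive a∈ , a≉0
    by-cases (no  none) = ⊥-elim (U≢0 (here ∘ all-zero , λ 0∈ → here (trans (∈-[]⁻ 0∈) (sym (all-zero (here refl))))))
      where
      all-zero : ∀ {u} → u ∈ U → u ≈ 0#
      all-zero {u} u∈ = decidable-stable (u ≟ 0#) λ u≉0 → none (Any.map (λ u≈v v≈0 → u≉0 (trans u≈v v≈0)) u∈)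

  Conclusion : ℕ → FinSubset → Set (c ⊔ ℓ)
  Conclusion k A = ∃[ S ] (IsSubring S × ∣ S ∣ ℕ.≤ σ k ℕ.* ∣ A ∣ ×
    ∃[ a ] (a ∈ A × IsInvertible D a × (a ·ˡ S) ≐ (S ·ʳ a) ×
      ∃[ X ] (NonEmpty X × ∣ X ∣ ℕ.≤ τ k × A ⊆ (a ·ˡ S) ⊕ X)))

  ∈⇒NonEmpty : ∀ {U x} → x ∈ U → NonEmpty U
  ∈⇒NonEmpty () ≡.refl

  -- Here `A` may still contain zero, whereas the threshold is tested after removing it; hence the
  -- factor `2`. The set itself serves as the set of translates of `{0}`.
  small-case : ∀ k {A a} → a ∈ A → ¬ (a ≈ 0#) → ∣ A ∣ ℕ.≤ 2 ℕ.* threshold k → Conclusion k A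
  small-case k {A} {a} a∈ a≉0 small =
    0# ∷ [] , subring , ℕ.*-mono-≤ (ℕ.m≤m+n 1 (κ k ℕ.* (suc (ε₂ k) ℕ.* suc (ε₂ k)))) (∈⇒card>0 {A} a∈) ,
    a , a∈ , division a a≉0 , (aS⊆Sa , Sa⊆aS) ,
    A , ∈⇒NonEmpty a∈ , ℕ.≤-trans small (ℕ.m≤m+n _ _) , covers
    where
    subring : IsSubring (0# ∷ [])
    subring = record
      { 0#-mem   = here refl
      ; +-closed = λ x∈ y∈ → here (trans (+-cong (∈-[]⁻ x∈) (∈-[]⁻ y∈)) (+-identityˡ 0#))
      ; -‿closed = λ x∈ → here (trans (-‿cong (∈-[]⁻ x∈)) -0#≈0#)
      ; *-closed = λ x∈ y∈ → here (trans (*-congʳ (∈-[]⁻ x∈)) (zeroˡ _))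
      }

    aS⊆Sa : a ·ˡ (0# ∷ []) ⊆ (0# ∷ []) ·ʳ a
    aS⊆Sa (here z≈) = here (trans z≈ (trans (zeroʳ a) (sym (zeroˡ a))))

    Sa⊆aS : (0# ∷ []) ·ʳ a ⊆ a ·ˡ (0# ∷ [])
    Sa⊆aS (here z≈) = here (trans z≈ (trans (zeroˡ a) (sym (zeroʳ a))))

    covers : A ⊆ (a ·ˡ (0# ∷ [])) ⊕ A
    covers {x} x∈ = ∈-resp (trans (+-congʳ (zeroʳ a)) (+-identityˡ x)) (∈-⊕⁺ {a ·ˡ (0# ∷ [])} (here refl) x∈)

  module _ (A₀ : FinSubset) (k₀ : ℕ)
           (A₀+A₀≤ : ∣ A₀ ⊕ A₀ ∣ ℕ.≤ k₀ ℕ.* ∣ A₀ ∣) (A₀*A₀≤ : ∣ A₀ ⊗ A₀ ∣ ℕ.≤ k₀ ℕ.* ∣ A₀ ∣)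
           {a₀ : Carrier} (a₀∈ : a₀ ∈ A₀) (a₀≉0 : ¬ (a₀ ≈ 0#)) where

    private
      -- Removing zero at most halves `A₀`, so both growth hypotheses persist with a doubled
      -- constant. It makes left multiplication by each element of `A` injective and the element `b`
      -- invertible.
      k : ℕ
      k = 2 ℕ.* k₀

      NonZero? : Unary.Decidable (λ x → ¬ (x ≈ 0#))
      NonZero? x = ¬? (x ≟ 0#)

      NonZero-resp : (λ x → ¬ (x ≈ 0#)) Respects _≈_
      NonZero-resp x≈y x≉0 y≈0 = x≉0 (trans x≈y y≈0)

      A : FinSubset
      A = filter NonZero? A₀

      A⁻ : ∀ {x} → x ∈ A → x ∈ A₀ × ¬ (x ≈ 0#)
      A⁻ = ∈-filter⁻ NonZero? NonZero-resp

      A⊆A₀ : A ⊆ A₀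
      A⊆A₀ = proj₁ ∘ A⁻

      A≢∅ : 0 ℕ.< ∣ A ∣
      A≢∅ = ∈⇒card>0 {A} (∈-filter⁺ NonZero? NonZero-resp a₀∈ a₀≉0)

      A₀≤2A : ∣ A₀ ∣ ℕ.≤ 2 ℕ.* ∣ A ∣
      A₀≤2A = ℕ.≤-trans (card-∪ {A₀} {0# ∷ []} {A} λ {x} x∈ → split x∈ (x ≟ 0#))
        (ℕ.≤-trans (ℕ.+-monoˡ-≤ ∣ A ∣ (ℕ.≤-trans (card≤length (0# ∷ [])) A≢∅))
          (ℕ.≤-reflexive (≡.cong (∣ A ∣ ℕ.+_) (≡.sym (ℕ.+-identityʳ ∣ A ∣)))))
        where
        split : ∀ {x} → x ∈ A₀ → Dec (x ≈ 0#) → x ∈ 0# ∷ [] ⊎ x ∈ A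
        split x∈ (yes x≈0) = inj₁ (here x≈0)
        split x∈ (no  x≉0) = inj₂ (∈-filter⁺ NonZero? NonZero-resp x∈ x≉0)

      k₀A₀≤kA : k₀ ℕ.* ∣ A₀ ∣ ℕ.≤ k ℕ.* ∣ A ∣
      k₀A₀≤kA = ℕ.≤-trans (ℕ.*-monoʳ-≤ k₀ A₀≤2A) (ℕ.≤-reflexive (rearrange k₀ ∣ A ∣))
        where
        rearrange : ∀ x y → x ℕ.* (2 ℕ.* y) ≡ 2 ℕ.* x ℕ.* y
        rearrange = solve-∀

      A+A≤ : ∣ A ⊕ A ∣ ℕ.≤ k ℕ.* ∣ A ∣
      A+A≤ = ℕ.≤-trans (card-mono {A ⊕ A} {A₀ ⊕ A₀} (⊕-mono {A} {A} A⊆A₀ A⊆A₀)) (ℕ.≤-trans A₀+A₀≤ k₀A₀≤kA)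

      A*A≤ : ∣ A ⊗ A ∣ ℕ.≤ k ℕ.* ∣ A ∣
      A*A≤ = ℕ.≤-trans (card-mono {A ⊗ A} {A₀ ⊗ A₀} ⊗-mono) (ℕ.≤-trans A₀*A₀≤ k₀A₀≤kA)
        where
        ⊗-mono : A ⊗ A ⊆ A₀ ⊗ A₀
        ⊗-mono z∈ with ∈-image₂⁻ _*_ A A z∈
        ... | x , y , x∈ , y∈ , z≈ = ∈-resp (sym z≈) (∈-⊗⁺ (A⊆A₀ x∈) (A⊆A₀ y∈))

      cancel : ∀ {a x y} → a ∈ A → a * x ≈ a * y → x ≈ y
      cancel {a} {x} {y} a∈ ax≈ay = trans (sym (cancelˡ-inverse a⁻¹a≈1 x)) (trans (*-congˡ ax≈ay) (cancelˡ-inverse a⁻¹a≈1 y))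
        where
        a⁻¹a≈1 : inv a * a ≈ 1#
        a⁻¹a≈1 = inv-inverseˡ (proj₂ (A⁻ a∈))

      large-case : threshold k ℕ.< ∣ A ∣ → Conclusion k A₀
      large-case large with PopularDilates.popular-dilates A k A≢∅ cancel A*A≤
      -- The covering lemma is applied to the original `A₀`, so zero needs no separate treatment.
      -- Since `A′ - A′` lies in `b S`, its translates turn into translates of `b S`.
      ... | b , A′ , b∈ , A′⊆A , A′-large , popular = conclude (ruzsa-covering A₀ A′ (proj₂ A′-inhabited))
        where
        b≉0 : ¬ (b ≈ 0#)
        b≉0 = proj₂ (A⁻ b∈)

        open LargeSets A k A≢∅ A+A≤ large b b≉0 A′ A′⊆A A′-large popular

        A′-inhabited : ∃[ x ] x ∈ A′
        A′-inhabited = card>0⇒∈ {A′} (ℕ.n≢0⇒n>0 λ A′≡0 → ℕ.<⇒≱ A≢∅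
          (ℕ.≤-trans A′-large (ℕ.≤-reflexive (≡.trans (≡.cong (2 ℕ.* k ℕ.*_) A′≡0) (ℕ.*-zeroʳ (2 ℕ.* k))))))

        A₀+A′≤ : ∣ A₀ ⊕ A′ ∣ ℕ.≤ 2 ℕ.* k ℕ.* k ℕ.* ∣ A′ ∣
        A₀+A′≤ = begin
          ∣ A₀ ⊕ A′ ∣                       ≤⟨ card-mono {A₀ ⊕ A′} {A₀ ⊕ A₀} (⊕-mono {A₀} {A′} id (A⊆A₀ ∘ A′⊆A)) ⟩
          ∣ A₀ ⊕ A₀ ∣                       ≤⟨ ℕ.≤-trans A₀+A₀≤ k₀A₀≤kA ⟩
          k ℕ.* ∣ A ∣                       ≤⟨ ℕ.*-monoʳ-≤ k A′-large ⟩
          k ℕ.* (2 ℕ.* k ℕ.* ∣ A′ ∣)        ≡⟨ rearrange k ∣ A′ ∣ ⟩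
          2 ℕ.* k ℕ.* k ℕ.* ∣ A′ ∣          ∎
          where
          open ℕ.≤-Reasoning
          rearrange : ∀ x y → x ℕ.* (2 ℕ.* x ℕ.* y) ≡ 2 ℕ.* x ℕ.* x ℕ.* y
          rearrange = solve-∀

        conclude : ∃[ X ] (X ⊆ A₀ × length X ℕ.* ∣ A′ ∣ ℕ.≤ ∣ A₀ ⊕ A′ ∣ × A₀ ⊆ (A′ ⊖ A′) ⊕ X) → Conclusion k A₀
        conclude (X , _ , X-bound , A₀⊆) =
          S , S-subring , S≤ ,
          b , A⊆A₀ b∈ , division b b≉0 , bS≐Sb ,
          X , X≢∅ , X≤ , λ {x} x∈ → ⊕-mono {A′ ⊖ A′} {X} (A′-A′⊆bS) id (A₀⊆ {x} x∈)
          where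
          S≤ : ∣ S ∣ ℕ.≤ σ k ℕ.* ∣ A₀ ∣
          S≤ = ℕ.≤-trans (card-S)
            (ℕ.≤-trans (ℕ.≤-reflexive (rearrange (κ k) ∣ A ∣ (suc (ε₂ k) ℕ.* suc (ε₂ k))))
              (ℕ.*-mono-≤ (ℕ.m≤n+m (κ k ℕ.* (suc (ε₂ k) ℕ.* suc (ε₂ k))) 1) (card-mono {A} {A₀} A⊆A₀)))
            where
            rearrange : ∀ x y z → x ℕ.* y ℕ.* z ≡ x ℕ.* z ℕ.* y
            rearrange = solve-∀

          X≢∅ : NonEmpty X
          X≢∅ with ∈-image₂⁻ _+_ (A′ ⊖ A′) X (A₀⊆ a₀∈)
          ... | _ , _ , _ , x∈ , _ = ∈⇒NonEmpty x∈

          X≤ : ∣ X ∣ ℕ.≤ τ k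
          X≤ = ℕ.≤-trans (card≤length X) (ℕ.≤-trans
            (ℕ.*-cancelʳ-≤ _ _ ∣ A′ ∣ {{ℕ.>-nonZero (∈⇒card>0 {A′} (proj₂ A′-inhabited))}} (ℕ.≤-trans X-bound A₀+A′≤))
            (ℕ.m≤n+m (2 ℕ.* k ℕ.* k) _))

    opaque
      sum-product-ℕ : Conclusion k A₀
      sum-product-ℕ with ∣ A ∣ ℕ.≤? threshold k
      ... | yes small = small-case k a₀∈ a₀≉0 (ℕ.≤-trans A₀≤2A (ℕ.*-monoʳ-≤ 2 small))
      ... | no  large = large-case (ℕ.≰⇒> large)

open import Data.Rational.Base using (ℚ; 0ℚ; 1ℚ; _≤_; _*_)

-- Natural numbers as rationals

toℚᵘ-fromℕ : ∀ n → ℚ.toℚᵘ (fromℕ n) ℚᵘ.≃ ℚᵘ.mkℚᵘ (ℤ.+ n) 0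
toℚᵘ-fromℕ n = ℚ.toℚᵘ-fromℚᵘ (ℚᵘ.mkℚᵘ (ℤ.+ n) 0)

fromℕ-mono : ∀ {m n} → m ℕ.≤ n → fromℕ m ≤ fromℕ n
fromℕ-mono {m} {n} m≤n = ℚ.toℚᵘ-cancel-≤ (begin
  ℚ.toℚᵘ (fromℕ m)      ≃⟨ toℚᵘ-fromℕ m ⟩
  ℚᵘ.mkℚᵘ (ℤ.+ m) 0     ≤⟨ ℚᵘ.*≤* (ℤ.*-monoʳ-≤-nonNeg (ℤ.+ 1) (ℤ.+≤+ m≤n)) ⟩
  ℚᵘ.mkℚᵘ (ℤ.+ n) 0     ≃⟨ toℚᵘ-fromℕ n ⟨
  ℚ.toℚᵘ (fromℕ n)      ∎)
  where open ℚᵘ.≤-Reasoning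

fromℕ-cancel : ∀ {m n} → fromℕ m ≤ fromℕ n → m ℕ.≤ n
fromℕ-cancel {m} {n} le = ℤ.drop‿+≤+ (ℤ.*-cancelʳ-≤-pos (ℤ.+ m) (ℤ.+ n) (ℤ.+ 1) (ℚᵘ.drop-*≤* (begin
  ℚᵘ.mkℚᵘ (ℤ.+ m) 0     ≃⟨ toℚᵘ-fromℕ m ⟨
  ℚ.toℚᵘ (fromℕ m)      ≤⟨ ℚ.toℚᵘ-mono-≤ le ⟩
  ℚ.toℚᵘ (fromℕ n)      ≃⟨ toℚᵘ-fromℕ n ⟩
  ℚᵘ.mkℚᵘ (ℤ.+ n) 0     ∎)))
  where open ℚᵘ.≤-Reasoning

fromℕ-* : ∀ m n → fromℕ (m ℕ.* n) ≡ fromℕ m * fromℕ n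
fromℕ-* m n = ℚ.toℚᵘ-injective (begin
  ℚ.toℚᵘ (fromℕ (m ℕ.* n))                    ≈⟨ toℚᵘ-fromℕ (m ℕ.* n) ⟩
  ℚᵘ.mkℚᵘ (ℤ.+ (m ℕ.* n)) 0                   ≈⟨ ℚᵘ.*≡* (≡.cong (ℤ._* ℤ.+ 1) (ℤ.pos-* m n)) ⟩
  ℚᵘ.mkℚᵘ (ℤ.+ m) 0 ℚᵘ.* ℚᵘ.mkℚᵘ (ℤ.+ n) 0    ≈⟨ ℚᵘ.*-cong (toℚᵘ-fromℕ m) (toℚᵘ-fromℕ n) ⟨
  ℚ.toℚᵘ (fromℕ m) ℚᵘ.* ℚ.toℚᵘ (fromℕ n)      ≈⟨ ℚ.toℚᵘ-homo-* (fromℕ m) (fromℕ n) ⟨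
  ℚ.toℚᵘ (fromℕ m * fromℕ n)                  ∎)
  where open import Relation.Binary.Reasoning.Setoid ℚᵘ.≃-setoid

fromℕ-suc : ∀ n → fromℕ (suc n) ≡ 1ℚ ℚ.+ fromℕ n
fromℕ-suc n = ℚ.toℚᵘ-injective (begin
  ℚ.toℚᵘ (fromℕ (suc n))             ≈⟨ toℚᵘ-fromℕ (suc n) ⟩
  ℚᵘ.mkℚᵘ (ℤ.+ suc n) 0              ≈⟨ ℚᵘ.*≡* (≡.cong (λ m → (ℤ.+ 1 ℤ.+ m) ℤ.* ℤ.+ 1) (≡.sym (ℤ.*-identityʳ (ℤ.+ n)))) ⟩
  ℚᵘ.1ℚᵘ ℚᵘ.+ ℚᵘ.mkℚᵘ (ℤ.+ n) 0      ≈⟨ ℚᵘ.+-congʳ ℚᵘ.1ℚᵘ (toℚᵘ-fromℕ n) ⟨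
  ℚᵘ.1ℚᵘ ℚᵘ.+ ℚ.toℚᵘ (fromℕ n)       ≈⟨ ℚ.toℚᵘ-homo-+ 1ℚ (fromℕ n) ⟨
  ℚ.toℚᵘ (1ℚ ℚ.+ fromℕ n)            ∎)
  where open import Relation.Binary.Reasoning.Setoid ℚᵘ.≃-setoid

0≤fromℕ : ∀ n → 0ℚ ≤ fromℕ n
0≤fromℕ n = fromℕ-mono {0} {n} ℕ.z≤n

*-mono-≤ : ∀ {p q r s} → 0ℚ ≤ q → 0ℚ ≤ r → p ≤ q → r ≤ s → p * r ≤ q * s
*-mono-≤ {p} {q} {r} {s} 0≤q 0≤r p≤q r≤s = ℚ.≤-trans
  (ℚ.*-monoʳ-≤-nonNeg r {{ℚ.nonNegative 0≤r}} p≤q)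
  (ℚ.*-monoˡ-≤-nonNeg q {{ℚ.nonNegative 0≤q}} r≤s)

-- From natural to rational constants

archimedean : ∀ K → ∃[ n ] K ≤ fromℕ n
archimedean (ℚ.mkℚ (ℤ.+ m) d-1 c) = m , ℚ.toℚᵘ-cancel-≤ (begin
  ℚᵘ.mkℚᵘ (ℤ.+ m) d-1   ≤⟨ ℚᵘ.*≤* (ℤ.*-monoˡ-≤-nonNeg (ℤ.+ m) (ℤ.+≤+ (ℕ.s≤s ℕ.z≤n))) ⟩
  ℚᵘ.mkℚᵘ (ℤ.+ m) 0     ≃⟨ toℚᵘ-fromℕ m ⟨
  ℚ.toℚᵘ (fromℕ m)      ∎)
  where open ℚᵘ.≤-Reasoning
archimedean (ℚ.mkℚ ℤ.-[1+ m ] d-1 c) = 0 , ℚ.*≤* ℤ.-≤+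

-- Descends to an integer whose predecessor is below `K`; the excess of at most `1` is absorbed by
-- `1 ≤ K`. An integer linear in `K` keeps polynomial bounds polynomial.
ceiling≤2K : ∀ {K} → 1ℚ ≤ K → ∃[ m ] (K ≤ fromℕ m × fromℕ m ≤ K ℚ.+ K)
ceiling≤2K {K} 1≤K = descend (proj₁ (archimedean K)) (proj₂ (archimedean K))
  where
  0≤K : 0ℚ ≤ K
  0≤K = ℚ.≤-trans (0≤fromℕ 1) 1≤K

  descend : ∀ N → K ≤ fromℕ N → ∃[ m ] (K ≤ fromℕ m × fromℕ m ≤ K ℚ.+ K)
  descend zero    K≤0 = 0 , K≤0 , ℚ.+-mono-≤ 0≤K 0≤K
  descend (suc N) K≤N+1 with K ℚ.≤? fromℕ N
  ... | yes K≤N = descend N K≤N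
  ... | no  K≰N = suc N , K≤N+1 , ≡.subst (_≤ K ℚ.+ K) (≡.sym (fromℕ-suc N))
                    (ℚ.+-mono-≤ 1≤K (ℚ.<⇒≤ (ℚ.≰⇒> K≰N)))

module _ {K : ℚ} (0≤K : 0ℚ ≤ K) where

  fromℕ-^ : ∀ c k → fromℕ k ≤ fromℕ c * K → ∀ e → fromℕ (k ℕ.^ e) ≤ fromℕ (c ℕ.^ e) * K ^ e
  fromℕ-^ c k k≤cK zero    = ℚ.≤-refl
  fromℕ-^ c k k≤cK (suc e) = begin
    fromℕ (k ℕ.* k ℕ.^ e)                        ≡⟨ fromℕ-* k (k ℕ.^ e) ⟩
    fromℕ k * fromℕ (k ℕ.^ e)
      ≤⟨ *-mono-≤ (ℚ.≤-trans (0≤fromℕ k) k≤cK) (0≤fromℕ (k ℕ.^ e)) k≤cK (fromℕ-^ c k k≤cK e) ⟩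
    (fromℕ c * K) * (fromℕ (c ℕ.^ e) * K ^ e)    ≡⟨ *-interchangeℚ (fromℕ c) K (fromℕ (c ℕ.^ e)) (K ^ e) ⟩
    (fromℕ c * fromℕ (c ℕ.^ e)) * (K * K ^ e)    ≡⟨ ≡.cong (_* (K * K ^ e)) (fromℕ-* c (c ℕ.^ e)) ⟨
    fromℕ (c ℕ.* c ℕ.^ e) * (K * K ^ e)          ∎
    where
    open ℚ.≤-Reasoning
    open Algebra.Properties.CommutativeSemigroup (CommutativeMonoid.commutativeSemigroup ℚ.*-1-commutativeMonoid) using ()
      renaming (interchange to *-interchangeℚ)

  -- Replacing `k` by `c K` moves the factor `c ^ e` into the constant and leaves the exponent
  -- unchanged.
  poly-bound : ∀ c e b k {m} → m ℕ.≤ b ℕ.* k ℕ.^ e → fromℕ k ≤ fromℕ c * K →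
               fromℕ m ≤ fromℕ (b ℕ.* c ℕ.^ e) * K ^ e
  poly-bound c e b k {m} m≤ k≤cK = begin
    fromℕ m                                ≤⟨ fromℕ-mono m≤ ⟩
    fromℕ (b ℕ.* k ℕ.^ e)                  ≡⟨ fromℕ-* b (k ℕ.^ e) ⟩
    fromℕ b * fromℕ (k ℕ.^ e)              ≤⟨ *-mono-≤ (0≤fromℕ b) (0≤fromℕ (k ℕ.^ e)) ℚ.≤-refl (fromℕ-^ c k k≤cK e) ⟩
    fromℕ b * (fromℕ (c ℕ.^ e) * K ^ e)    ≡⟨ ℚ.*-assoc (fromℕ b) (fromℕ (c ℕ.^ e)) (K ^ e) ⟨
    fromℕ b * fromℕ (c ℕ.^ e) * K ^ e      ≡⟨ ≡.cong (_* K ^ e) (fromℕ-* b (c ℕ.^ e)) ⟨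
    fromℕ (b ℕ.* c ℕ.^ e) * K ^ e          ∎
    where open ℚ.≤-Reasoning

-- k = 2 m with m ≤ 2 K, whence the factors 4 ^ e.
C₁ e₁ C₂ e₂ : ℕ
e₁ = proj₁ (proj₂ poly-σ)
C₁ = proj₁ poly-σ ℕ.* 4 ℕ.^ e₁
e₂ = proj₁ (proj₂ poly-τ)
C₂ = proj₁ poly-τ ℕ.* 4 ℕ.^ e₂

-- The theorem for rational `K`

module _ {c ℓ} (D : Ring c ℓ) (division : IsDivisionRing D) (_≟_ : Decidable (Ring._≈_ D)) where
  open Ring D using (_≈_; 0#)
  open FiniteSubsets D _≟_

  sum-product-ℚ : ∀ A → NonEmpty A → ¬ (A ≐ [ 0# ]) → ∀ (K : ℚ) → 1ℚ ≤ K →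
                  fromℕ ∣ A ⊕ A ∣ ≤ K * fromℕ ∣ A ∣ → fromℕ ∣ A ⊗ A ∣ ≤ K * fromℕ ∣ A ∣ →
                  ∃[ S ] (IsSubring S × fromℕ ∣ S ∣ ≤ fromℕ C₁ * K ^ e₁ * fromℕ ∣ A ∣ ×
                    ∃[ a ] (a ∈ A × IsInvertible D a × (a ·ˡ S) ≐ (S ·ʳ a) ×
                      ∃[ X ] (NonEmpty X × fromℕ ∣ X ∣ ≤ fromℕ C₂ * K ^ e₂ × A ⊆ (a ·ˡ S) ⊕ X)))
  sum-product-ℚ A A≢∅ A≢0 K 1≤K A+A≤ A*A≤ =
    let S , subring , S≤ , a , a∈ , a-inv , aS≐Sa , X , X≢∅ , X≤ , A⊆ =
          DivisionRing.sum-product-ℕ D division _≟_ A m (natural-bound A+A≤) (natural-bound A*A≤)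
            (proj₁ (proj₂ nonzero)) (proj₂ (proj₂ nonzero))
    in S , subring , σ-bound S≤ , a , a∈ , a-inv , aS≐Sa , X , X≢∅ , τ-bound X≤ , λ {x} → A⊆ {x}
    where
    nonzero : ∃[ a ] (a ∈ A × ¬ (a ≈ 0#))
    nonzero = DivisionRing.nonzero-element D division _≟_ A A≢∅ A≢0

    m k : ℕ
    m = proj₁ (ceiling≤2K 1≤K)
    k = 2 ℕ.* m

    K≤m : K ≤ fromℕ m
    K≤m = proj₁ (proj₂ (ceiling≤2K 1≤K))

    natural-bound : ∀ {s} → fromℕ s ≤ K * fromℕ ∣ A ∣ → s ℕ.≤ m ℕ.* ∣ A ∣
    natural-bound {s} s≤ = fromℕ-cancel (begin
      fromℕ s                  ≤⟨ s≤ ⟩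
      K * fromℕ ∣ A ∣          ≤⟨ ℚ.*-monoʳ-≤-nonNeg (fromℕ ∣ A ∣) {{ℚ.nonNegative (0≤fromℕ ∣ A ∣)}} K≤m ⟩
      fromℕ m * fromℕ ∣ A ∣    ≡⟨ fromℕ-* m ∣ A ∣ ⟨
      fromℕ (m ℕ.* ∣ A ∣)      ∎)
      where open ℚ.≤-Reasoning

    0≤K : 0ℚ ≤ K
    0≤K = ℚ.≤-trans (0≤fromℕ 1) 1≤K

    1≤k : 1 ℕ.≤ k
    1≤k = ℕ.≤-trans (fromℕ-cancel {1} {m} (ℚ.≤-trans 1≤K K≤m)) (ℕ.m≤m+n m _)

    k≤4K : fromℕ k ≤ fromℕ 4 * K
    k≤4K = begin
      fromℕ (2 ℕ.* m)          ≡⟨ fromℕ-* 2 m ⟩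
      fromℕ 2 * fromℕ m
        ≤⟨ ℚ.*-monoˡ-≤-nonNeg (fromℕ 2) {{ℚ.nonNegative (0≤fromℕ 2)}} (proj₂ (proj₂ (ceiling≤2K 1≤K))) ⟩
      fromℕ 2 * (K ℚ.+ K)      ≡⟨ ≡.cong (fromℕ 2 *_) (≡.cong₂ ℚ._+_ (ℚ.*-identityˡ K) (ℚ.*-identityˡ K)) ⟨
      -- Closed rationals are evaluated: `1ℚ ℚ.+ 1ℚ` is `fromℕ 2` here, and `fromℕ 2 * fromℕ 2` is
      -- `fromℕ 4` in the next step.
      fromℕ 2 * (1ℚ * K ℚ.+ 1ℚ * K)  ≡⟨ ≡.cong (fromℕ 2 *_) (ℚ.*-distribʳ-+ K 1ℚ 1ℚ) ⟨
      fromℕ 2 * (fromℕ 2 * K)  ≡⟨ ℚ.*-assoc (fromℕ 2) (fromℕ 2) K ⟨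
      fromℕ 4 * K              ∎
      where open ℚ.≤-Reasoning

    σ-bound : ∀ {s} → s ℕ.≤ σ k ℕ.* ∣ A ∣ → fromℕ s ≤ fromℕ C₁ * K ^ e₁ * fromℕ ∣ A ∣
    σ-bound {s} s≤ = begin
      fromℕ s                               ≤⟨ fromℕ-mono s≤ ⟩
      fromℕ (σ k ℕ.* ∣ A ∣)                 ≡⟨ fromℕ-* (σ k) ∣ A ∣ ⟩
      fromℕ (σ k) * fromℕ ∣ A ∣
        ≤⟨ ℚ.*-monoʳ-≤-nonNeg (fromℕ ∣ A ∣) {{ℚ.nonNegative (0≤fromℕ ∣ A ∣)}}
             (poly-bound 0≤K 4 e₁ (proj₁ poly-σ) k (proj₂ (proj₂ poly-σ) k 1≤k) k≤4K) ⟩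
      fromℕ C₁ * K ^ e₁ * fromℕ ∣ A ∣       ∎
      where open ℚ.≤-Reasoning

    τ-bound : ∀ {s} → s ℕ.≤ τ k → fromℕ s ≤ fromℕ C₂ * K ^ e₂
    τ-bound s≤ = poly-bound 0≤K 4 e₂ (proj₁ poly-τ) k (ℕ.≤-trans s≤ (proj₂ (proj₂ poly-τ) k 1≤k)) k≤4K

theorem5p2 : ∀ (c ℓ : Level) →
    ∃[ C₁ ] ∃[ e₁ ] ∃[ C₂ ] ∃[ e₂ ]
    (∀ (D : Ring c ℓ) → IsDivisionRing D →
    ∀ (_≟_ : Decidable (Ring._≈_ D)) →
    let open FiniteSubsets D _≟_ in
    ∀ (A : FinSubset) → NonEmpty A → ¬ (A ≐ [ Ring.0# D ]) →
    ∀ (K : ℚ) → 1ℚ ≤ K →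
    fromℕ ∣ A ⊕ A ∣ ≤ K * fromℕ ∣ A ∣ →
    fromℕ ∣ A ⊗ A ∣ ≤ K * fromℕ ∣ A ∣ →
    ∃[ S ] (IsSubring S
    × fromℕ ∣ S ∣ ≤ fromℕ C₁ * K ^ e₁ * fromℕ ∣ A ∣
    × ∃[ a ] (a ∈ A
    × IsInvertible D a
    × (a ·ˡ S) ≐ (S ·ʳ a)
    × ∃[ X ] (NonEmpty X
    × fromℕ ∣ X ∣ ≤ fromℕ C₂ * K ^ e₂
    × A ⊆ (a ·ˡ S) ⊕ X))))
theorem5p2 c ℓ = C₁ , e₁ , C₂ , e₂ , sum-product-ℚ
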